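{- Let $p,n$ be positive integers with $p\ge n-1\ge 4$, and write $p=k(n-1)+r$ with $k$ a positive integer and $r\in\{0,1,\ldots,n-2\}$. Then $$ex(p;T_n^2)=\max\Big\{\Big[\tfrac{(n-2)p}2\Big]-(n-1+r),\ \tfrac{(n-2)p-r(n-1-r)}2\Big\},$$ and explicitly $$ex(p;T_n^2)=\begin{cases}[\frac{(n-2)p}2]-(n-1+r) & \text{if } n\ge 16 \text{ and } 3\le r\le n-6,\ \text{or if } 13\le n\le 15 \text{ and } 4\le r\le n-7,\\ \frac{(n-2)p-r(n-1-r)}2 & \text{otherwise.}\end{cases}$$
   Context: All graphs are finite and simple. For a graph $L$ and a positive integer $p$, $ex(p;L)$ denotes the maximum number of edges of a graph on $p$ vertices that contains no subgraph isomorphic to $L$. $[x]$ denotes the greatest integer not exceeding $x$. For $n\ge 5$, $T_n^2$ is the tree with vertex set $\{v_0,v_1,\ldots,v_{n-1}\}$ and edge set $\{v_0v_1,v_0v_2,\ldots,v_0v_{n-3},\ v_{n-3}v_{n-2},\ v_{n-3}v_{n-1}\}$. -}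

module Defs where

open import Data.Nat using (ℕ; zero; suc; _+_; _*_; _∸_; _≤_; _<_; _⊔_; _/_)
open import Data.Bool using (Bool; true; false; if_then_else_)
open import Data.Fin using (Fin; toℕ; _<?_)
open import Data.List using (List; map; allFin)
open import Data.Nat.ListAction using (sum)
open import Data.Product using (Σ; _×_; ∃-syntax)
open import Data.Sum using (_⊎_)
open import Relation.Nullary using (¬_; does)
open import Relation.Binary.PropositionalEquality using (_≡_)
open import Function.Definitions using (Injective)

record Graph (p : ℕ) : Set where
  field
    adj    : Fin p → Fin p → Bool
    sym    : ∀ i j → adj i j ≡ adj j i
    irrefl : ∀ i → adj i i ≡ false
open Graph public

edgeCount : ∀ {p} → Graph p → ℕ
edgeCount {p} G =
  sum (map (λ i → sum (map (λ j →
        if does (i <? j) then (if adj G i j then 1 else 0) else 0)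
      (allFin p))) (allFin p))

T2Edge : ℕ → ℕ → ℕ → Set
T2Edge n i j =
  (i ≡ 0 × 1 ≤ j × j ≤ n ∸ 3) ⊎ (i ≡ n ∸ 3 × (j ≡ n ∸ 2 ⊎ j ≡ n ∸ 1))

ContainsT2 : ∀ {p} → ℕ → Graph p → Set
ContainsT2 {p} n G =
  Σ (Fin n → Fin p) λ f → Injective _≡_ _≡_ f ×
    (∀ (a b : Fin n) → T2Edge n (toℕ a) (toℕ b) → adj G (f a) (f b) ≡ true)

IsExT2 : ℕ → ℕ → ℕ → Set
IsExT2 p n m =
  (Σ (Graph p) λ G → ¬ ContainsT2 n G × edgeCount G ≡ m) ×
  (∀ (G : Graph p) → ¬ ContainsT2 n G → edgeCount G ≤ m)

-- [ (n-2)p/2 ] - (n-1+r)   (nonnegative under the hypotheses)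
valA : ℕ → ℕ → ℕ → ℕ
valA p n r = ((n ∸ 2) * p) / 2 ∸ (n ∸ 1 + r)

-- ((n-2)p - r(n-1-r)) / 2   (an exact nonnegative even numerator under the hypotheses)
valB : ℕ → ℕ → ℕ → ℕ
valB p n r = ((n ∸ 2) * p ∸ r * (n ∸ 1 ∸ r)) / 2

CaseA : ℕ → ℕ → Set
CaseA n r = (16 ≤ n × 3 ≤ r × r ≤ n ∸ 6) ⊎ (13 ≤ n × n ≤ 15 × 4 ≤ r × r ≤ n ∸ 7)

{-# OPTIONS --safe #-}

-- Put m = n − 1.  Upper bound: induct on the vertex set U.  If some degree is
-- at least m − 2, excluding the tree confines the neighbourhoods of the
-- neighbours of such a vertex so strongly that one can delete either m vertices
-- meeting at most m(m − 1)/2 edges, or m − 1 vertices meeting at most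
-- (m − 1)(m − 2)/2 edges; otherwise U spans at most (m − 3)|U|/2 edges.  With
-- |U| = k m + r, each alternative preserves the bound
--   2 e ≤ k m (m − 1) + max (r(r − 1), (m − 3) r − 2m).
-- Lower bound: k cliques K_m with a K_r, or k − 1 cliques K_m with a graph on
-- m + r vertices that is (m − 3)-regular up to parity, a circulant graph plus
-- possibly a matching.
module Submission where

open import Defs
open import Data.Bool using (Bool; true; false; _∧_; _∨_; not; if_then_else_)
open import Data.Bool.Properties using (∧-identityʳ; ∧-zeroʳ; ∨-comm; ∨-zeroʳ; T-≡)
import Data.Bool.Properties as Bool
open import Data.Empty using (⊥; ⊥-elim)
open import Data.Fin
  using (Fin; zero; suc; toℕ; cast; fromℕ; fromℕ<; inject≤; inject₁; join; splitAt; _↑ˡ_; _↑ʳ_; _<?_)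
open import Data.Fin.Properties
  using (_≟_; any?; injective⇒≤; inject≤-injective; join-splitAt; splitAt-<; splitAt-↑ˡ; splitAt-↑ʳ;
         splitAt⁻¹-↑ˡ; splitAt⁻¹-↑ʳ; toℕ-cast; toℕ-fromℕ; toℕ-injective; toℕ-inject₁; toℕ-inject≤;
         toℕ-↑ʳ; toℕ<n)
import Data.Fin.Properties as Fin
import Data.List as List hiding (sum)
import Data.List.Properties as List
open import Data.Nat
  using (ℕ; zero; suc; _+_; _*_; _∸_; _≤_; _<_; _⊔_; _/_; ∣_-_∣; _≤?_; _<ᵇ_; _≡ᵇ_; z≤n; s≤s)
open import Data.Nat.DivMod using (m%n<n; m*n/n≡m; m/n*n≤m; m≡m%n+[m/n]*n; /-monoˡ-≤)
import Data.Nat.ListAction as List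
open import Data.Nat.Properties hiding (_≟_; _<?_)
open import Data.Nat.Tactic.RingSolver using (solve-∀)
open import Data.Product using (Σ; _×_; _,_; proj₁; proj₂; ∃-syntax)
open import Data.Sum using (_⊎_; inj₁; inj₂; [_,_]′)
open import Function using (_∘_; id)
open import Function.Bundles using (Equivalence)
open import Relation.Binary.Definitions using (tri<; tri≈; tri>)
open import Relation.Binary.PropositionalEquality
  using (_≡_; _≢_; refl; cong; cong₂; subst; trans; module ≡-Reasoning)
  renaming (sym to ≡-sym)
open import Relation.Nullary using (¬_; yes; no; does; contradiction)
open import Relation.Nullary.Decidable using (dec-true; dec-false; _×-dec_)
open import Algebra.Properties.CommutativeMonoid.Sum +-0-commutativeMonoid
  using (sum; sum-syntax; sum-cong-≗; sum-init-last; ∑-comm; ∑-distrib-+)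
open import Algebra.Properties.Semiring.Sum +-*-semiring using (*-distribˡ-sum; *-distribʳ-sum)

-- The centre of the tree has degree n - 3 = m - 2. Hence graphs of maximum degree m - 3 are free
-- for a local reason and K_m is free for lack of room; the two values compare these two kinds of
-- block. Edges are counted twice, so a deletion becomes a matter of charges: each deleted vertex
-- `i` is charged `W`, and the average charge must be at most one less than the number of deleted
-- vertices. The hard case is maximum degree exactly m - 2, at `u` say. The closed neighbourhood `S`
-- of `u` then has only m - 1 vertices, and some `v` in `S` may be charged m - 1 instead of m - 2.
-- This forces `v` to have degree m - 2 and a single neighbour `w` outside `S`, hence to miss
-- exactly one `v′` in `S`. Adding `w` to `S` gives m vertices, but neither `v′` nor `w` meets the
-- charge m - 1 on its own. The excess is paid by the neighbours of `v′` in `S`: such a neighbour is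
-- joined to `v` too, and another neighbour outside `S` and `w` would complete the tree centred at
-- `v`, so each of them saves one unit.

-- Sums and cardinalities over sets of vertices

-- Vertex sets are Boolean predicates, so that sums over a set are sums over
-- all of Fin p weighted by the indicator ⟦_⟧.
VSet : ℕ → Set
VSet p = Fin p → Bool

infix 4 _∈_ _∉_ _⊆_
infixl 6 _∖_

_∈_ _∉_ : ∀ {p} → Fin p → VSet p → Set
x ∈ P = P x ≡ true
x ∉ P = P x ≡ false

_⊆_ : ∀ {p} → VSet p → VSet p → Set
P ⊆ Q = ∀ x → x ∈ P → x ∈ Q

_∖_ : ∀ {p} → VSet p → Fin p → VSet p
(P ∖ x) j = P j ∧ not (does (j ≟ x))

⟦_⟧ : Bool → ℕ
⟦ true ⟧  = 1
⟦ false ⟧ = 0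

count : ∀ {p} → VSet p → ℕ
count {p} P = ∑[ i < p ] ⟦ P i ⟧

true≢false : true ≢ false
true≢false ()

∧-intro : ∀ {a b} → a ≡ true → b ≡ true → a ∧ b ≡ true
∧-intro refl refl = refl

∧-fst : ∀ {a b} → a ∧ b ≡ true → a ≡ true
∧-fst {true} _ = refl

∧-snd : ∀ {a b} → a ∧ b ≡ true → b ≡ true
∧-snd {true} h = h

not-intro : ∀ {a} → a ≡ false → not a ≡ true
not-intro refl = refl

not-elim : ∀ {a} → not a ≡ true → a ≡ false
not-elim {false} _ = refl

¬true⇒false : ∀ {a} → a ≢ true → a ≡ false
¬true⇒false {true}  h = ⊥-elim (h refl)
¬true⇒false {false} _ = refl

⟦⟧-mono : ∀ {a b} → (a ≡ true → b ≡ true) → ⟦ a ⟧ ≤ ⟦ b ⟧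
⟦⟧-mono {false}         _ = z≤n
⟦⟧-mono {true} {true}  _ = ≤-refl
⟦⟧-mono {true} {false} h = contradiction (h refl) λ ()

⟦⟧≤1 : ∀ b → ⟦ b ⟧ ≤ 1
⟦⟧≤1 true  = ≤-refl
⟦⟧≤1 false = z≤n

∈-∖ : ∀ {p} (P : VSet p) {x j} → j ∈ P → j ≢ x → j ∈ (P ∖ x)
∈-∖ P {x} {j} j∈P j≢x = ∧-intro j∈P (not-intro (dec-false (j ≟ x) j≢x))

∖-⊆ : ∀ {p} (P : VSet p) {x j} → j ∈ (P ∖ x) → j ∈ P
∖-⊆ P = ∧-fst

∖-≢ : ∀ {p} (P : VSet p) {x j} → j ∈ (P ∖ x) → j ≢ x
∖-≢ P {x} j∈ refl = true≢false (trans (≡-sym (∧-snd {P x} j∈)) (cong not (dec-true (x ≟ x) refl)))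

∑-mono : ∀ {p} {f g : Fin p → ℕ} → (∀ i → f i ≤ g i) → sum f ≤ sum g
∑-mono {zero}  _ = z≤n
∑-mono {suc p} h = +-mono-≤ (h zero) (∑-mono (h ∘ suc))

∑-const : ∀ p c → ∑[ i < p ] c ≡ p * c
∑-const zero    c = refl
∑-const (suc p) c = cong (c +_) (∑-const p c)

∑-zero : ∀ {p} {f : Fin p → ℕ} → (∀ i → f i ≡ 0) → sum f ≡ 0
∑-zero {zero}  _ = refl
∑-zero {suc p} h = cong₂ _+_ (h zero) (∑-zero (h ∘ suc))

∑-↑ : ∀ a {b} (f : Fin (a + b) → ℕ) →
      sum f ≡ (∑[ i < a ] f (i ↑ˡ b)) + (∑[ j < b ] f (a ↑ʳ j))
∑-↑ zero    f = refl
∑-↑ (suc a) f = trans (cong (f zero +_) (∑-↑ a (f ∘ suc))) (≡-sym (+-assoc (f zero) _ _))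

∑-single : ∀ {p} (x : Fin p) → ∑[ j < p ] ⟦ does (j ≟ x) ⟧ ≡ 1
∑-single {suc p} zero    = cong suc (∑-zero {p} λ _ → refl)
∑-single {suc p} (suc x) = trans (sum-cong-≗ (λ j → cong ⟦_⟧ (lem j))) (∑-single x)
  where
  lem : ∀ j → does (suc j ≟ suc x) ≡ does (j ≟ x)
  lem j with j ≟ x
  ... | yes _ = refl
  ... | no _  = refl

∑≤count*bound : ∀ {p} (P : VSet p) (f : Fin p → ℕ) b → (∀ i → i ∈ P → f i ≤ b) →
                ∑[ i < p ] (⟦ P i ⟧ * f i) ≤ count P * b
∑≤count*bound P f b h =
  ≤-trans (∑-mono term) (≤-reflexive (≡-sym (*-distribʳ-sum b (λ i → ⟦ P i ⟧))))
  where
  term : ∀ i → ⟦ P i ⟧ * f i ≤ ⟦ P i ⟧ * b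
  term i with P i in eq
  ... | true  = +-monoˡ-≤ 0 (h i eq)
  ... | false = z≤n

count-mono : ∀ {p} (P Q : VSet p) → P ⊆ Q → count P ≤ count Q
count-mono P Q h = ∑-mono (λ i → ⟦⟧-mono (h i))

count-cong : ∀ {p} (P Q : VSet p) → (∀ i → P i ≡ Q i) → count P ≡ count Q
count-cong P Q h = sum-cong-≗ (λ i → cong ⟦_⟧ (h i))

count-all : ∀ p → count {p} (λ _ → true) ≡ p
count-all p = trans (∑-const p 1) (*-identityʳ p)

count-split : ∀ {p} (P Q : VSet p) →
              count P ≡ count (λ i → P i ∧ Q i) + count (λ i → P i ∧ not (Q i))
count-split P Q = trans (sum-cong-≗ (λ i → pointwise (P i) (Q i))) (∑-distrib-+ (λ i → ⟦ P i ∧ Q i ⟧) (λ i → ⟦ P i ∧ not (Q i) ⟧))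
  where
  pointwise : ∀ a b → ⟦ a ⟧ ≡ ⟦ a ∧ b ⟧ + ⟦ a ∧ not b ⟧
  pointwise true  true  = refl
  pointwise true  false = refl
  pointwise false _     = refl

count-∖ : ∀ {p} (P : VSet p) {x} → x ∈ P → count P ≡ suc (count (P ∖ x))
count-∖ P {x} x∈P =
  trans (count-split P (λ i → does (i ≟ x)))
        (cong (_+ count (P ∖ x)) (trans (count-cong _ (λ i → does (i ≟ x)) only-x) (∑-single x)))
  where
  only-x : ∀ i → P i ∧ does (i ≟ x) ≡ does (i ≟ x)
  only-x i with i ≟ x
  ... | yes refl = cong (_∧ true) x∈P
  ... | no _     = ∧-zeroʳ (P i)

count-∉ : ∀ {p} (P : VSet p) {x} → x ∉ P → count P ≤ count (P ∖ x)
count-∉ P {x} x∉P = count-mono P (P ∖ x) λ j j∈P → ∈-∖ P j∈P λ { refl → true≢false (trans (≡-sym j∈P) x∉P) }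

count-∖-≤ : ∀ {p} (P : VSet p) x → count P ≤ suc (count (P ∖ x))
count-∖-≤ P x with P x in eq
... | true  = ≤-reflexive (count-∖ P eq)
... | false = m≤n⇒m≤1+n (count-∉ P eq)

abstract
  -- Later arguments use only the stated properties of such a witness; `abstract` keeps the search
  -- itself from unfolding.
  count>0⇒∃ : ∀ {p} (P : VSet p) → 1 ≤ count P → ∃[ x ] x ∈ P
  count>0⇒∃ {suc p} P h with P zero in eq
  ... | true  = zero , eq
  ... | false with count>0⇒∃ (P ∘ suc) h
  ...   | x , x∈P = suc x , x∈P

∈⇒count>0 : ∀ {p} (P : VSet p) {x} → x ∈ P → 1 ≤ count P
∈⇒count>0 P x∈P = subst (1 ≤_) (≡-sym (count-∖ P x∈P)) (s≤s z≤n)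

abstract
  count≥2⇒∃₂ : ∀ {p} (P : VSet p) → 2 ≤ count P → ∃[ x ] ∃[ y ] x ∈ P × y ∈ P × x ≢ y
  count≥2⇒∃₂ P h with count>0⇒∃ P (<⇒≤ h)
  ... | x , x∈P with count>0⇒∃ (P ∖ x) (≤-pred (subst (2 ≤_) (count-∖ P x∈P) h))
  ...   | y , y∈ = x , y , x∈P , ∖-⊆ P y∈ , λ x≡y → ∖-≢ P y∈ (≡-sym x≡y)

insert : ∀ {p} → Fin p → VSet p → VSet p
insert x Q j = does (j ≟ x) ∨ Q j

insert-elim : ∀ {p} (Q : VSet p) {x j} → j ∈ insert x Q → j ≡ x ⊎ j ∈ Q
insert-elim Q {x} {j} j∈ with j ≟ x
... | yes j≡x = inj₁ j≡x
... | no _    = inj₂ j∈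

count-insert : ∀ {p} (Q : VSet p) {x} → x ∉ Q → count (insert x Q) ≡ suc (count Q)
count-insert Q {x} x∉Q =
  trans (count-∖ (insert x Q) (cong (_∨ Q x) (dec-true (x ≟ x) refl)))
        (cong suc (count-cong (insert x Q ∖ x) Q drop-x))
  where
  drop-x : ∀ j → (insert x Q ∖ x) j ≡ Q j
  drop-x j with j ≟ x
  ... | yes refl = ≡-sym x∉Q
  ... | no _     = ∧-identityʳ (Q j)

abstract
  subset-of-size : ∀ {p} (P : VSet p) k → k ≤ count P → ∃[ Q ] Q ⊆ P × count Q ≡ k
  subset-of-size {p} P zero    _ = (λ _ → false) , (λ _ ()) , ∑-zero {p} (λ _ → refl)
  subset-of-size P (suc k) h with count>0⇒∃ P (≤-trans (s≤s z≤n) h)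
  ... | x , x∈P with subset-of-size (P ∖ x) k (≤-pred (subst (suc k ≤_) (count-∖ P x∈P) h))
  ...   | Q , Q⊆ , |Q|≡k =
    insert x Q ,
    (λ j j∈ → [ (λ { refl → x∈P }) , (λ j∈Q → ∖-⊆ P (Q⊆ j j∈Q)) ]′ (insert-elim Q j∈)) ,
    trans (count-insert Q (¬true⇒false λ x∈Q → ∖-≢ P (Q⊆ x x∈Q) refl)) (cong suc |Q|≡k)

injection⇒≤count : ∀ {p k} (P : VSet p) (f : Fin k → Fin p) → (∀ i → f i ∈ P) →
                   (∀ {i j} → f i ≡ f j → i ≡ j) → k ≤ count P
injection⇒≤count {k = zero}  P f _ _   = z≤n
injection⇒≤count {k = suc k} P f f∈ inj =
  subst (suc k ≤_) (≡-sym (count-∖ P (f∈ zero)))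
    (s≤s (injection⇒≤count (P ∖ f zero) (f ∘ suc)
      (λ i → ∈-∖ P (f∈ (suc i)) λ eq → contradiction (inj eq) λ ())
      (λ eq → Fin.suc-injective (inj eq))))

-- The forbidden tree and the deletion of vertices

extend : ∀ {p k} → Fin p → (Fin k → Fin p) → Fin (suc k) → Fin p
extend x g zero    = x
extend x g (suc i) = g i

abstract
  choose : ∀ {p} (P : VSet p) k → k ≤ count P →
           Σ (Fin k → Fin p) λ g → (∀ i → g i ∈ P) × (∀ {i j} → g i ≡ g j → i ≡ j)
  choose {p} P zero    _ = (λ ()) , (λ ()) , λ { {()} }
  choose {p} P (suc k) h with count>0⇒∃ P (≤-trans (s≤s z≤n) h)
  ... | x , x∈P with choose (P ∖ x) k (≤-pred (subst (suc k ≤_) (count-∖ P x∈P) h))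
  ...   | g , g∈ , g-inj = extend x g , ext∈ , λ {i} {j} → ext-inj i j
    where
    ext∈ : ∀ i → extend x g i ∈ P
    ext∈ zero    = x∈P
    ext∈ (suc i) = ∖-⊆ P (g∈ i)
    ext-inj : ∀ i j → extend x g i ≡ extend x g j → i ≡ j
    ext-inj zero    zero    _  = refl
    ext-inj zero    (suc j) eq = ⊥-elim (∖-≢ P (g∈ j) (≡-sym eq))
    ext-inj (suc i) zero    eq = ⊥-elim (∖-≢ P (g∈ i) eq)
    ext-inj (suc i) (suc j) eq = cong suc (g-inj eq)

adj⇒≢ : ∀ {p} (G : Graph p) {i j} → adj G i j ≡ true → i ≢ j
adj⇒≢ G {i} a refl = true≢false (trans (≡-sym a) (irrefl G i))

adj-sym : ∀ {p} (G : Graph p) {i j} → adj G i j ≡ true → adj G j i ≡ true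
adj-sym G {i} {j} a = trans (Graph.sym G j i) a

-- `u` plays v_0, `v` plays v_(n-3), and `x`, `y` are the two leaves at `v`; the other n - 4 =
-- `1 + c` leaves at `u` are drawn from `P`.
embed : ∀ {p} c (G : Graph p) {u v x y} (P : VSet p) →
        adj G u v ≡ true → adj G v x ≡ true → adj G v y ≡ true →
        x ≢ y → x ≢ u → y ≢ u →
        (∀ j → j ∈ P → adj G u j ≡ true × j ≢ v × j ≢ x × j ≢ y) →
        1 + c ≤ count P → ContainsT2 (5 + c) G
embed {p} c G {u} {v} {x} {y} P uv vx vy x≢y x≢u y≢u P⇒ 1+c≤|P|
  with choose P (1 + c) 1+c≤|P|
... | g , g∈ , g-inj = f , f-inj , f-edge
  where
  h : Fin 3 → Fin p
  h zero             = v
  h (suc zero)       = x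
  h (suc (suc zero)) = y

  h-inj : ∀ i j → h i ≡ h j → i ≡ j
  h-inj zero zero _ = refl
  h-inj zero (suc zero) eq = ⊥-elim (adj⇒≢ G vx eq)
  h-inj zero (suc (suc zero)) eq = ⊥-elim (adj⇒≢ G vy eq)
  h-inj (suc zero) zero eq = ⊥-elim (adj⇒≢ G vx (≡-sym eq))
  h-inj (suc zero) (suc zero) _ = refl
  h-inj (suc zero) (suc (suc zero)) eq = ⊥-elim (x≢y eq)
  h-inj (suc (suc zero)) zero eq = ⊥-elim (adj⇒≢ G vy (≡-sym eq))
  h-inj (suc (suc zero)) (suc zero) eq = ⊥-elim (x≢y (≡-sym eq))
  h-inj (suc (suc zero)) (suc (suc zero)) _ = refl

  u≢h : ∀ i → u ≢ h i
  u≢h zero             = adj⇒≢ G uv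
  u≢h (suc zero)       = x≢u ∘ ≡-sym
  u≢h (suc (suc zero)) = y≢u ∘ ≡-sym

  g≢h : ∀ i j → g i ≢ h j
  g≢h i zero             = proj₁ (proj₂ (P⇒ _ (g∈ i)))
  g≢h i (suc zero)       = proj₁ (proj₂ (proj₂ (P⇒ _ (g∈ i))))
  g≢h i (suc (suc zero)) = proj₂ (proj₂ (proj₂ (P⇒ _ (g∈ i))))

  e : 4 + c ≡ suc c + 3
  e = cong suc (+-comm 3 c)

  gh : Fin (suc c) ⊎ Fin 3 → Fin p
  gh = [ g , h ]′

  gh-inj : ∀ s t → gh s ≡ gh t → s ≡ t
  gh-inj (inj₁ i) (inj₁ j) eq = cong inj₁ (g-inj eq)
  gh-inj (inj₁ i) (inj₂ j) eq = ⊥-elim (g≢h i j eq)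
  gh-inj (inj₂ i) (inj₁ j) eq = ⊥-elim (g≢h j i (≡-sym eq))
  gh-inj (inj₂ i) (inj₂ j) eq = cong inj₂ (h-inj i j eq)

  u≢gh : ∀ s → u ≢ gh s
  u≢gh (inj₁ i) = adj⇒≢ G (proj₁ (P⇒ _ (g∈ i)))
  u≢gh (inj₂ j) = u≢h j

  -- Positions 1 to n - 4 of the tree are the leaves at `u`; the last three positions are `v`, `x`,
  -- `y` in this order.
  at : Fin (4 + c) → Fin (suc c) ⊎ Fin 3
  at i = splitAt (suc c) (cast e i)

  f : Fin (5 + c) → Fin p
  f zero    = u
  f (suc i) = gh (at i)

  f-inj : ∀ {i j} → f i ≡ f j → i ≡ j
  f-inj {zero}  {zero}  _  = refl
  f-inj {zero}  {suc j} eq = ⊥-elim (u≢gh (at j) eq)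
  f-inj {suc i} {zero}  eq = ⊥-elim (u≢gh (at i) (≡-sym eq))
  f-inj {suc i} {suc j} eq = cong suc (toℕ-injective (begin
    toℕ i           ≡⟨ toℕ-cast e i ⟨
    toℕ (cast e i)  ≡⟨ cong toℕ cast-eq ⟩
    toℕ (cast e j)  ≡⟨ toℕ-cast e j ⟩
    toℕ j           ∎))
    where
    open ≡-Reasoning
    cast-eq : cast e i ≡ cast e j
    cast-eq = trans (≡-sym (join-splitAt (suc c) 3 (cast e i)))
                (trans (cong (join (suc c) 3) (gh-inj (at i) (at j) eq))
                       (join-splitAt (suc c) 3 (cast e j)))

  f-tail : ∀ i k → toℕ i ≡ suc c + toℕ k → f (suc i) ≡ h k
  f-tail i k eq = cong gh (trans (cong (splitAt (suc c)) i≡) (splitAt-↑ʳ (suc c) 3 k))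
    where
    i≡ : cast e i ≡ suc c ↑ʳ k
    i≡ = toℕ-injective (trans (toℕ-cast e i) (trans eq (≡-sym (toℕ-↑ʳ (suc c) k))))

  f-tail′ : ∀ i k → toℕ i ≡ suc c + toℕ k → ∀ {z} → adj G z (h k) ≡ true → adj G z (f (suc i)) ≡ true
  f-tail′ i k eq {z} = subst (λ t → adj G z t ≡ true) (≡-sym (f-tail i k eq))

  f-edge : ∀ a b → T2Edge (5 + c) (toℕ a) (toℕ b) → adj G (f a) (f b) ≡ true
  f-edge zero zero    (inj₁ (_ , () , _))
  f-edge zero (suc b) (inj₁ (_ , _ , s≤s b≤1+c)) with m≤n⇒m<n∨m≡n b≤1+c
  ... | inj₂ b≡1+c = f-tail′ b zero (trans b≡1+c (≡-sym (+-identityʳ _))) uv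
  ... | inj₁ b<1+c =
    subst (λ t → adj G u (gh t) ≡ true)
          (≡-sym (splitAt-< (suc c) (cast e b) (subst (_< suc c) (≡-sym (toℕ-cast e b)) b<1+c)))
          (proj₁ (P⇒ _ (g∈ (fromℕ< (subst (_< suc c) (≡-sym (toℕ-cast e b)) b<1+c)))))
  f-edge (suc a) zero    (inj₂ (_ , inj₁ ()))
  f-edge (suc a) zero    (inj₂ (_ , inj₂ ()))
  f-edge (suc a) (suc b) (inj₂ (a≡ , b≡)) =
    subst (λ t → adj G t (f (suc b)) ≡ true)
          (≡-sym (f-tail a zero (trans (suc-injective a≡) (≡-sym (+-identityʳ _)))))
          (leaf b≡)
    where
    leaf : suc (toℕ b) ≡ 3 + c ⊎ suc (toℕ b) ≡ 4 + c → adj G v (f (suc b)) ≡ true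
    leaf (inj₁ eq) = f-tail′ b (suc zero) (trans (suc-injective eq) (cong suc (+-comm 1 c))) vx
    leaf (inj₂ eq) = f-tail′ b (suc (suc zero)) (trans (suc-injective eq) (cong suc (+-comm 2 c))) vy

infixl 6 _─_

_─_ : ∀ {p} → VSet p → VSet p → VSet p
(P ─ Q) j = P j ∧ not (Q j)

nbrs : ∀ {p} → Graph p → VSet p → Fin p → VSet p
nbrs G U i j = U j ∧ adj G i j

deg : ∀ {p} → Graph p → VSet p → Fin p → ℕ
deg G U i = count (nbrs G U i)

-- Twice the number of edges induced on U.
E : ∀ {p} → Graph p → VSet p → ℕ
E {p} G U = ∑[ i < p ] (⟦ U i ⟧ * deg G U i)

-- Deleting S from U destroys, counted twice, Σ_{i ∈ S} W i edges: an edge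
-- inside S is seen from both ends, one leaving S is counted twice at its S-end.
W : ∀ {p} → Graph p → VSet p → VSet p → Fin p → ℕ
W G U S i = deg G U i + deg G (U ─ S) i

count-─ : ∀ {p} (U S : VSet p) → S ⊆ U → count U ≡ count S + count (U ─ S)
count-─ U S S⊆U = trans (count-split U S) (cong (_+ count (U ─ S)) (count-cong _ S eq))
  where
  eq : ∀ i → U i ∧ S i ≡ S i
  eq i with S i in s
  ... | true  = ∧-intro (S⊆U i s) refl
  ... | false = ∧-zeroʳ (U i)

deg-─ : ∀ {p} (G : Graph p) (U S : VSet p) → S ⊆ U → ∀ i → deg G U i ≡ deg G S i + deg G (U ─ S) i
deg-─ G U S S⊆U i =
  trans (sum-cong-≗ λ j → pointwise (U j) (S j) (adj G i j) (S⊆U j))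
        (∑-distrib-+ (λ j → ⟦ nbrs G S i j ⟧) (λ j → ⟦ nbrs G (U ─ S) i j ⟧))
  where
  pointwise : ∀ u s a → (s ≡ true → u ≡ true) → ⟦ u ∧ a ⟧ ≡ ⟦ s ∧ a ⟧ + ⟦ (u ∧ not s) ∧ a ⟧
  pointwise true  true  a _ = ≡-sym (+-identityʳ _)
  pointwise true  false a _ = refl
  pointwise false true  a h = contradiction (h refl) λ ()
  pointwise false false a _ = refl

-- Double counting of adjacent pairs between `P` and `Q`. In `E-remove` it moves the edges seen from
-- the surviving vertices over to their ends in `S`.
deg-exchange : ∀ {p} (G : Graph p) (P Q : VSet p) →
               ∑[ i < p ] (⟦ P i ⟧ * deg G Q i) ≡ ∑[ i < p ] (⟦ Q i ⟧ * deg G P i)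
deg-exchange {p} G P Q = begin
  ∑[ i < p ] (⟦ P i ⟧ * deg G Q i)
    ≡⟨ sum-cong-≗ (λ i → *-distribˡ-sum ⟦ P i ⟧ (λ j → ⟦ nbrs G Q i j ⟧)) ⟩
  ∑[ i < p ] (∑[ j < p ] (⟦ P i ⟧ * ⟦ Q j ∧ adj G i j ⟧))
    ≡⟨ ∑-comm (λ i j → ⟦ P i ⟧ * ⟦ Q j ∧ adj G i j ⟧) ⟩
  ∑[ j < p ] (∑[ i < p ] (⟦ P i ⟧ * ⟦ Q j ∧ adj G i j ⟧))
    ≡⟨ sum-cong-≗ (λ j → sum-cong-≗ (λ i → pointwise i j)) ⟩
  ∑[ j < p ] (∑[ i < p ] (⟦ Q j ⟧ * ⟦ P i ∧ adj G j i ⟧))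
    ≡⟨ sum-cong-≗ (λ j → *-distribˡ-sum ⟦ Q j ⟧ (λ i → ⟦ nbrs G P j i ⟧)) ⟨
  ∑[ j < p ] (⟦ Q j ⟧ * deg G P j) ∎
  where
  open ≡-Reasoning
  swap : ∀ a b c → ⟦ a ⟧ * ⟦ b ∧ c ⟧ ≡ ⟦ b ⟧ * ⟦ a ∧ c ⟧
  swap true  true  _ = refl
  swap true  false _ = refl
  swap false true  _ = refl
  swap false false _ = refl
  pointwise : ∀ i j → ⟦ P i ⟧ * ⟦ Q j ∧ adj G i j ⟧ ≡ ⟦ Q j ⟧ * ⟦ P i ∧ adj G j i ⟧
  pointwise i j = trans (swap (P i) (Q j) (adj G i j))
                        (cong (λ t → ⟦ Q j ⟧ * ⟦ P i ∧ t ⟧) (Graph.sym G i j))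

E-remove : ∀ {p} (G : Graph p) (U S : VSet p) → S ⊆ U →
           E G U ≡ E G (U ─ S) + ∑[ i < p ] (⟦ S i ⟧ * W G U S i)
E-remove {p} G U S S⊆U = begin
  E G U
    ≡⟨ sum-cong-≗ (λ i → trans (cong (_* deg G U i) (U≡ (U i) (S i) (S⊆U i)))
                               (*-distribʳ-+ (deg G U i) ⟦ V i ⟧ ⟦ S i ⟧)) ⟩
  ∑[ i < p ] (⟦ V i ⟧ * deg G U i + ⟦ S i ⟧ * deg G U i)
    ≡⟨ ∑-distrib-+ (λ i → ⟦ V i ⟧ * deg G U i) SU ⟩
  ∑[ i < p ] (⟦ V i ⟧ * deg G U i) + sum SU
    ≡⟨ cong (_+ sum SU) (trans (sum-cong-≗ (λ i → trans (cong (⟦ V i ⟧ *_) (deg-─ G U S S⊆U i))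
                                                    (*-distribˡ-+ ⟦ V i ⟧ (deg G S i) (deg G V i))))
                         (∑-distrib-+ (λ i → ⟦ V i ⟧ * deg G S i) (λ i → ⟦ V i ⟧ * deg G V i))) ⟩
  (∑[ i < p ] (⟦ V i ⟧ * deg G S i) + E G V) + sum SU
    ≡⟨ cong (λ t → (t + E G V) + sum SU) (deg-exchange G V S) ⟩
  (sum SV + E G V) + sum SU
    ≡⟨ cong (_+ sum SU) (+-comm (sum SV) (E G V)) ⟩
  (E G V + sum SV) + sum SU
    ≡⟨ +-assoc (E G V) (sum SV) (sum SU) ⟩
  E G V + (sum SV + sum SU)
    ≡⟨ cong (E G V +_) (trans (+-comm (sum SV) (sum SU)) (≡-sym (∑-distrib-+ SU SV))) ⟩
  E G V + ∑[ i < p ] (SU i + SV i)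
    ≡⟨ cong (E G V +_) (sum-cong-≗ (λ i → ≡-sym (*-distribˡ-+ ⟦ S i ⟧ (deg G U i) (deg G V i)))) ⟩
  E G V + ∑[ i < p ] (⟦ S i ⟧ * W G U S i) ∎
  where
  open ≡-Reasoning
  V : VSet p
  V = U ─ S
  SU SV : Fin p → ℕ
  SU i = ⟦ S i ⟧ * deg G U i
  SV i = ⟦ S i ⟧ * deg G V i
  U≡ : ∀ u s → (s ≡ true → u ≡ true) → ⟦ u ⟧ ≡ ⟦ u ∧ not s ⟧ + ⟦ s ⟧
  U≡ true  true  _ = refl
  U≡ true  false _ = refl
  U≡ false true  h = contradiction (h refl) λ ()
  U≡ false false _ = refl

-- Reductions in a graph without the tree

∑-pick : ∀ {p} (x : Fin p) b → ∑[ i < p ] (⟦ does (i ≟ x) ⟧ * b) ≡ b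
∑-pick {p} x b = begin
  ∑[ i < p ] (⟦ does (i ≟ x) ⟧ * b)  ≡⟨ *-distribʳ-sum b (λ i → ⟦ does (i ≟ x) ⟧) ⟨
  ∑[ i < p ] ⟦ does (i ≟ x) ⟧ * b    ≡⟨ cong (_* b) (∑-single x) ⟩
  1 * b                              ≡⟨ *-identityˡ b ⟩
  b                                  ∎
  where open ≡-Reasoning

─-⊆ : ∀ {p} (U S : VSet p) → (U ─ S) ⊆ U
─-⊆ U S _ = ∧-fst

deg-mono : ∀ {p} (G : Graph p) (U V : VSet p) → U ⊆ V → ∀ i → deg G U i ≤ deg G V i
deg-mono G U V U⊆V i = count-mono (nbrs G U i) (nbrs G V i)
  λ j j∈ → ∧-intro (U⊆V j (∧-fst j∈)) (∧-snd {U j} j∈)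

closedNbhd : ∀ {p} → Graph p → VSet p → Fin p → VSet p
closedNbhd G U u j = U j ∧ (does (j ≟ u) ∨ adj G u j)

module _ {p} (G : Graph p) (U : VSet p) {u : Fin p} (u∈U : u ∈ U) where

  private
    S : VSet p
    S = closedNbhd G U u

  closedNbhd-⊆ : S ⊆ U
  closedNbhd-⊆ _ = ∧-fst

  centre∈closedNbhd : u ∈ S
  centre∈closedNbhd = ∧-intro u∈U (cong (_∨ adj G u u) (dec-true (u ≟ u) refl))

  closedNbhd-elim : ∀ {j} → j ∈ S → j ≡ u ⊎ adj G u j ≡ true
  closedNbhd-elim {j} j∈S with j ≟ u | ∧-snd {U j} j∈S
  ... | yes j≡u | _  = inj₁ j≡u
  ... | no _    | uj = inj₂ uj

  outside-closedNbhd : ∀ {j} → j ∈ (U ─ S) → j ≢ u × adj G u j ≡ false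
  outside-closedNbhd {j} j∈ = j≢u , ¬true⇒false λ uj → j∉S (∧-intro (∧-fst j∈) (trans (cong (does (j ≟ u) ∨_) uj) (∨-zeroʳ _)))
    where
    j∉S : j ∈ S → ⊥
    j∉S j∈S = true≢false (trans (≡-sym j∈S) (not-elim (∧-snd {U j} j∈)))
    j≢u : j ≢ u
    j≢u refl = j∉S centre∈closedNbhd

  count-closedNbhd : count S ≡ suc (deg G U u)
  count-closedNbhd = trans (count-∖ S centre∈closedNbhd)
                           (cong suc (count-cong (S ∖ u) (nbrs G U u) eq))
    where
    eq : ∀ j → (S ∖ u) j ≡ nbrs G U u j
    eq j with j ≟ u
    ... | yes refl = trans (∧-zeroʳ _) (≡-sym (trans (cong (U j ∧_) (irrefl G j)) (∧-zeroʳ _)))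
    ... | no _     = ∧-identityʳ _

  deg-outside-centre : deg G (U ─ S) u ≡ 0
  deg-outside-centre = n≤0⇒n≡0 (≮⇒≥ λ 1≤ → let w , w∈ = count>0⇒∃ (nbrs G (U ─ S) u) 1≤ in
    true≢false (trans (≡-sym (∧-snd {(U ─ S) w} w∈)) (proj₂ (outside-closedNbhd (∧-fst w∈)))))

  deg-outside : ∀ {x} → adj G u x ≡ true → suc (deg G (U ─ S) x) ≤ deg G U x
  deg-outside {x} ux = subst (suc (deg G (U ─ S) x) ≤_)
    (≡-sym (count-∖ (nbrs G U x) (∧-intro u∈U (adj-sym G ux))))
    (s≤s (count-mono (nbrs G (U ─ S) x) (nbrs G U x ∖ u)
      λ j j∈ → ∈-∖ (nbrs G U x) (∧-intro (∧-fst {U j} (∧-fst j∈)) (∧-snd {(U ─ S) j} j∈))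
                    (proj₁ (outside-closedNbhd (∧-fst j∈)))))

module TFree {p} c (G : Graph p) (free : ¬ ContainsT2 (5 + c) G) (U : VSet p) where

  module _ {u v x y : Fin p} (uv : adj G u v ≡ true) (vx : adj G v x ≡ true) (vy : adj G v y ≡ true)
           (x≢y : x ≢ y) (x≢u : x ≢ u) (y≢u : y ≢ u) where

    private
      N N₁ N₂ : VSet p
      N  = nbrs G U u
      N₁ = N ∖ v
      N₂ = N₁ ∖ x

    not-enough-leaves : ¬ (1 + c ≤ count (N₂ ∖ y))
    not-enough-leaves h = free (embed c G (N₂ ∖ y) uv vx vy x≢y x≢u y≢u
      (λ j j∈ → let j∈N₂ = ∖-⊆ N₂ j∈ ; j∈N₁ = ∖-⊆ N₁ j∈N₂ in
        ∧-snd {U j} (∖-⊆ N j∈N₁) , ∖-≢ N j∈N₁ , ∖-≢ N₁ j∈N₂ , ∖-≢ N₂ j∈) h)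

    -- `v`, `x` and `y` must be taken out of the neighbourhood of `u` before `1 + c` leaves are
    -- chosen there. Each of `x`, `y` that is not adjacent to `u` costs nothing, which lowers the
    -- threshold by one in each of the next two lemmas.
    deg<4+c : ¬ (4 + c ≤ deg G U u)
    deg<4+c h = not-enough-leaves (≤-pred (≤-trans (≤-pred (≤-trans (≤-pred
      (≤-trans h (count-∖-≤ N v))) (count-∖-≤ N₁ x))) (count-∖-≤ N₂ y)))

    deg<3+c : adj G u x ≡ false → ¬ (3 + c ≤ deg G U u)
    deg<3+c u≁x h = not-enough-leaves (≤-pred (≤-trans (≤-trans (≤-pred
      (≤-trans h (count-∖-≤ N v))) (count-∉ N₁ x∉)) (count-∖-≤ N₂ y)))
      where
      x∉ : x ∉ N₁
      x∉ = ¬true⇒false λ x∈ → true≢false (trans (≡-sym (∧-snd {U x} (∖-⊆ N x∈))) u≁x)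

    deg<2+c : adj G u x ≡ false → adj G u y ≡ false → ¬ (2 + c ≤ deg G U u)
    deg<2+c u≁x u≁y h = not-enough-leaves (≤-trans (≤-trans (≤-pred
      (≤-trans h (count-∖-≤ N v))) (count-∉ N₁ x∉)) (count-∉ N₂ y∉))
      where
      x∉ : x ∉ N₁
      x∉ = ¬true⇒false λ x∈ → true≢false (trans (≡-sym (∧-snd {U x} (∖-⊆ N x∈))) u≁x)
      y∉ : y ∉ N₂
      y∉ = ¬true⇒false λ y∈ → true≢false (trans (≡-sym (∧-snd {U y} (∖-⊆ N (∖-⊆ N₁ y∈)))) u≁y)

  Cost : VSet p → ℕ
  Cost S = ∑[ i < p ] (⟦ S i ⟧ * W G U S i)

  -- Either U is sparse, or some set of n − 1 (or n − 2) vertices can be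
  -- deleted at the cost of at most the edges of the complete graph on it.
  data Reduction : Set where
    sparse   : E G U ≤ count U * (1 + c) → Reduction
    delete   : ∀ S → S ⊆ U → count S ≡ 4 + c → Cost S ≤ (4 + c) * (3 + c) → Reduction
    delete⁻¹ : ∀ S → S ⊆ U → count S ≡ 3 + c → Cost S ≤ (3 + c) * (2 + c) → Reduction

  Cost-bound : ∀ S s b → count S ≡ s → (∀ i → i ∈ S → W G U S i ≤ b) → Cost S ≤ s * b
  Cost-bound S _ b refl h = ∑≤count*bound S (W G U S) b h

  W≤2deg : ∀ S i → W G U S i ≤ deg G U i + deg G U i
  W≤2deg S i = +-monoʳ-≤ (deg G U i) (deg-mono G (U ─ S) U (─-⊆ U S) i)

  two-other-nbrs : ∀ {u x} → u ∈ nbrs G U x → 3 ≤ deg G U x →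
                   ∃[ y ] ∃[ z ] adj G x y ≡ true × adj G x z ≡ true × y ≢ z × y ≢ u × z ≢ u
  two-other-nbrs {u} {x} u∈ 3≤deg
    with count≥2⇒∃₂ (nbrs G U x ∖ u) (≤-pred (subst (3 ≤_) (count-∖ (nbrs G U x) u∈) 3≤deg))
  ... | y , z , y∈ , z∈ , y≢z =
    y , z , ∧-snd {U y} (∖-⊆ N y∈) , ∧-snd {U z} (∖-⊆ N z∈) , y≢z , ∖-≢ N y∈ , ∖-≢ N z∈
    where
    N : VSet p
    N = nbrs G U x

  -- The degree is doubled to match `W≤2deg`. Two neighbours of `x` besides `u` would complete the
  -- tree, so the degree is at most 2; the resulting 4 exceeds `3 + c` only for `c = 0`, where
  -- degree 2 must be excluded as well.
  nbr-of-hub : ∀ {u x} → u ∈ U → x ∈ nbrs G U u → 4 + c ≤ deg G U u →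
               deg G U x + deg G U x ≤ 3 + c
  nbr-of-hub {u} {x} u∈U x∈N hub = bound c refl
    where
    N Nx : VSet p
    N  = nbrs G U u
    Nx = nbrs G U x
    ux : adj G u x ≡ true
    ux = ∧-snd {U x} x∈N
    u∈Nx : u ∈ Nx
    u∈Nx = ∧-intro u∈U (adj-sym G ux)

    deg≤2 : deg G U x ≤ 2
    deg≤2 = ≮⇒≥ λ 3≤deg → let y , z , xy , xz , y≢z , y≢u , z≢u = two-other-nbrs u∈Nx 3≤deg in
      deg<4+c ux xy xz y≢z y≢u z≢u hub

    -- For n = 5 a path x′ – x – u with two more neighbours of u is the
    -- forbidden tree with the roles of its two centres exchanged.
    deg≤1 : c ≡ 0 → deg G U x ≤ 1
    deg≤1 refl = ≮⇒≥ λ 2≤deg →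
      let z , z∈ = count>0⇒∃ (Nx ∖ u) (≤-pred (subst (2 ≤_) (count-∖ Nx u∈Nx) 2≤deg))
          y₁ , y₂ , y₁∈ , y₂∈ , y₁≢y₂ = count≥2⇒∃₂ (N ∖ x ∖ z)
            (≤-pred (≤-trans (≤-pred (≤-trans hub (count-∖-≤ N x))) (count-∖-≤ (N ∖ x) z)))
          xz = ∧-snd {U z} (∖-⊆ Nx z∈)
          leaf : ∀ {y} → y ∈ (N ∖ x ∖ z) → adj G u y ≡ true × y ≢ x × y ≢ z
          leaf {y} y∈ = ∧-snd {U y} (∖-⊆ N (∖-⊆ (N ∖ x) y∈)) , ∖-≢ N (∖-⊆ (N ∖ x) y∈) , ∖-≢ (N ∖ x) y∈
          uy₁ , y₁≢x , y₁≢z = leaf y₁∈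
          uy₂ , y₂≢x , y₂≢z = leaf y₂∈
      in free (embed 0 G (λ j → does (j ≟ z)) (adj-sym G ux) uy₁ uy₂ y₁≢y₂ y₁≢x y₂≢x
           (λ j j∈ → only-z xz (∖-≢ Nx z∈) (y₁≢z ∘ ≡-sym) (y₂≢z ∘ ≡-sym) j j∈)
           (≤-reflexive (≡-sym (∑-single z))))
      where
      only-z : ∀ {z y₁ y₂} → adj G x z ≡ true → z ≢ u → z ≢ y₁ → z ≢ y₂ → ∀ j → does (j ≟ z) ≡ true →
               adj G x j ≡ true × j ≢ u × j ≢ y₁ × j ≢ y₂
      only-z {z} xz z≢u z≢y₁ z≢y₂ j j≟z with j ≟ z
      ... | yes refl = xz , z≢u , z≢y₁ , z≢y₂
      only-z xz z≢u z≢y₁ z≢y₂ j () | no _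

    bound : ∀ c′ → c ≡ c′ → deg G U x + deg G U x ≤ 3 + c
    bound zero     eq = ≤-trans (+-mono-≤ (deg≤1 eq) (deg≤1 eq)) (m≤m+n 2 (1 + c))
    bound (suc c′) eq = ≤-trans (+-mono-≤ deg≤2 deg≤2)
                                (subst (λ t → 4 ≤ 3 + t) (≡-sym eq) (m≤m+n 4 c′))

  -- Only neighbours of `u` are deleted: they are cheap, whereas the degree of `u` itself has no
  -- upper bound here.
  reduce-hub : ∀ {u} → u ∈ U → 4 + c ≤ deg G U u → Reduction
  reduce-hub {u} u∈U hub with subset-of-size (nbrs G U u) (4 + c) hub
  ... | S , S⊆N , |S| = delete S (λ j j∈S → ∧-fst (S⊆N j j∈S)) |S|
    (Cost-bound S (4 + c) (3 + c) |S| λ i i∈S → ≤-trans (W≤2deg S i) (nbr-of-hub u∈U (S⊆N i i∈S) hub))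

  -- The closed neighbourhood has exactly n - 1 vertices. A neighbour of `u` without an edge leaving
  -- it is charged its degree, at most `3 + c`; one with such an edge has degree at most 2, and
  -- since one neighbour is `u` its charge is at most 3.
  reduce-n-2 : (∀ x → x ∈ U → deg G U x ≤ 3 + c) → ∀ {u} → u ∈ U → deg G U u ≡ 3 + c → Reduction
  reduce-n-2 Δ {u} u∈U deg-u = delete S (closedNbhd-⊆ G U u∈U) |S| (Cost-bound S (4 + c) (3 + c) |S| W≤)
    where
    S : VSet p
    S = closedNbhd G U u
    |S| : count S ≡ 4 + c
    |S| = trans (count-closedNbhd G U u∈U) (cong suc deg-u)

    no-third-nbr : ∀ {x w} → adj G u x ≡ true → w ∈ (U ─ S) → adj G x w ≡ true → ¬ (3 ≤ deg G U x)
    no-third-nbr {x} {w} ux w∈out xw 3≤deg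
      with outside-closedNbhd G U u∈U w∈out | two-other-nbrs (∧-intro u∈U (adj-sym G ux)) 3≤deg
    -- `w` may coincide with `y` or `z`; one of the two differs from it and serves as the second
    -- leaf.
    ... | w≢u , u≁w | y , z , xy , xz , y≢z , y≢u , z≢u with w ≟ y
    ...   | yes refl = deg<3+c ux xw xz y≢z w≢u z≢u u≁w (≤-reflexive (≡-sym deg-u))
    ...   | no w≢y   = deg<3+c ux xw xy w≢y w≢u y≢u u≁w (≤-reflexive (≡-sym deg-u))

    nbr : ∀ {x} → adj G u x ≡ true → x ∈ U → W G U S x ≤ 3 + c
    nbr {x} ux x∈U with 1 ≤? deg G (U ─ S) x
    ... | no out<1 = ≤-trans (+-mono-≤ (Δ x x∈U) (≤-pred (≰⇒> out<1))) (≤-reflexive (+-identityʳ _))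
    ... | yes 1≤out with count>0⇒∃ (nbrs G (U ─ S) x) 1≤out
    ...   | w , w∈ = ≤-trans (+-mono-≤ deg≤2 (≤-pred (≤-trans (deg-outside G U u∈U ux) deg≤2))) (m≤m+n 3 c)
      where
      deg≤2 : deg G U x ≤ 2
      deg≤2 = ≮⇒≥ (no-third-nbr ux (∧-fst w∈) (∧-snd {(U ─ S) w} w∈))

    W≤ : ∀ x → x ∈ S → W G U S x ≤ 3 + c
    W≤ x x∈S with closedNbhd-elim G U u∈U x∈S
    ... | inj₁ refl = ≤-reflexive (trans (cong₂ _+_ deg-u (deg-outside-centre G U u∈U)) (+-identityʳ _))
    ... | inj₂ ux   = nbr ux (∧-fst x∈S)

  module Tight (Δ : ∀ x → x ∈ U → deg G U x ≤ 2 + c) {u} (u∈U : u ∈ U) (deg-u : deg G U u ≡ 2 + c) where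

    S : VSet p
    S = closedNbhd G U u

    S⊆U : S ⊆ U
    S⊆U = closedNbhd-⊆ G U u∈U

    |S| : count S ≡ 3 + c
    |S| = trans (count-closedNbhd G U u∈U) (cong suc deg-u)

    out : Fin p → ℕ
    out = deg G (U ─ S)

    out-u : out u ≡ 0
    out-u = deg-outside-centre G U u∈U

    -- Two outside neighbours are both non-adjacent to `u`, and for such a pair of leaves degree
    -- `2 + c` at `u` already yields the tree.
    out≤1 : ∀ x → x ∈ S → out x ≤ 1
    out≤1 x x∈S with closedNbhd-elim G U u∈U x∈S
    ... | inj₁ refl = ≤-trans (≤-reflexive out-u) z≤n
    ... | inj₂ ux   = ≮⇒≥ λ 2≤out → absurd (count≥2⇒∃₂ (nbrs G (U ─ S) x) 2≤out)
      where
      absurd : ∃[ y ] ∃[ z ] y ∈ nbrs G (U ─ S) x × z ∈ nbrs G (U ─ S) x × y ≢ z → ⊥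
      absurd (y , z , y∈ , z∈ , y≢z)
        with outside-closedNbhd G U u∈U (∧-fst y∈) | outside-closedNbhd G U u∈U (∧-fst z∈)
      ... | y≢u , u≁y | z≢u , u≁z =
        deg<2+c ux (∧-snd {(U ─ S) y} y∈) (∧-snd {(U ─ S) z} z∈) y≢z y≢u z≢u u≁y u≁z
                (≤-reflexive (≡-sym deg-u))

    module Escape {v w} (v∈S : v ∈ S) (deg-v : deg G U v ≡ 2 + c) (w∈ : w ∈ nbrs G (U ─ S) v) where

      w∈U : w ∈ U
      w∈U = ─-⊆ U S w (∧-fst w∈)

      w∉S : w ∉ S
      w∉S = not-elim (∧-snd {U w} (∧-fst w∈))

      out-v : out v ≡ 1
      out-v = ≤-antisym (out≤1 v v∈S) (∈⇒count>0 (nbrs G (U ─ S) v) w∈)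

      escapes-to-w : ∀ {y} → y ∈ (U ─ S) → adj G v y ≡ true → y ≡ w
      escapes-to-w {y} y∈ vy with y ≟ w
      ... | yes y≡w = y≡w
      ... | no y≢w  = contradiction
        (≤-trans (s≤s (∈⇒count>0 (N ∖ w) (∈-∖ N (∧-intro y∈ vy) y≢w)))
                 (≤-trans (≤-reflexive (≡-sym (count-∖ N w∈))) (out≤1 v v∈S)))
        (λ { (s≤s ()) })
        where
        N : VSet p
        N = nbrs G (U ─ S) v

      missed : VSet p
      missed x = (S ∖ v) x ∧ not (adj G v x)

      -- Of the `2 + c` neighbours of `v` only `w` lies outside `S`, so `1 + c` of them lie among
      -- the `2 + c` members of `S ∖ v`.
      |missed| : count missed ≡ 1
      |missed| = +-cancelˡ-≡ (1 + c) _ _ (begin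
        (1 + c) + count missed                           ≡⟨ cong (_+ count missed) inner ⟨
        count (λ x → (S ∖ v) x ∧ adj G v x) + count missed ≡⟨ count-split (S ∖ v) (adj G v) ⟨
        count (S ∖ v)                                    ≡⟨ suc-injective (trans (≡-sym (count-∖ S v∈S)) |S|) ⟩
        2 + c                                            ≡⟨ +-comm 1 (1 + c) ⟩
        (1 + c) + 1                                      ∎)
        where
        open ≡-Reasoning
        same : ∀ x → (S ∖ v) x ∧ adj G v x ≡ nbrs G S v x
        same x with x ≟ v
        ... | yes refl = trans (cong ((S x ∧ false) ∧_) (irrefl G x))
                           (trans (∧-zeroʳ _) (≡-sym (trans (cong (S x ∧_) (irrefl G x)) (∧-zeroʳ _))))
        ... | no _     = cong (_∧ adj G v x) (∧-identityʳ (S x))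
        inner : count (λ x → (S ∖ v) x ∧ adj G v x) ≡ 1 + c
        inner = trans (count-cong _ (nbrs G S v) same) (+-cancelʳ-≡ 1 _ _
          (trans (cong (deg G S v +_) (≡-sym out-v))
            (trans (≡-sym (deg-─ G U S S⊆U v)) (trans deg-v (+-comm 1 (1 + c))))))

      module Missed {v′} (v′∈ : v′ ∈ missed) where

        v′∈S : v′ ∈ S
        v′∈S = ∖-⊆ S (∧-fst v′∈)

        v′≢v : v′ ≢ v
        v′≢v = ∖-≢ S (∧-fst v′∈)

        v≁v′ : adj G v v′ ≡ false
        v≁v′ = not-elim (∧-snd {(S ∖ v) v′} v′∈)

        v-sees : ∀ {x} → x ∈ S → x ≢ v → x ≢ v′ → adj G v x ≡ true
        v-sees {x} x∈S x≢v x≢v′ with adj G v x in vx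
        ... | true  = refl
        ... | false = contradiction
          (≤-trans (s≤s (∈⇒count>0 (missed ∖ v′) (∈-∖ missed (∧-intro (∈-∖ S x∈S x≢v) (not-intro vx)) x≢v′)))
                   (≤-reflexive (trans (≡-sym (count-∖ missed v′∈)) |missed|)))
          (λ { (s≤s ()) })

        S′ Q : VSet p
        S′ = insert w S
        Q  = S ∖ v′

        S⊆S′ : S ⊆ S′
        S⊆S′ x x∈S = trans (cong (does (x ≟ w) ∨_) x∈S) (∨-zeroʳ _)

        out′⊆ : (U ─ S′) ⊆ (U ─ S)
        out′⊆ x x∈ = ∧-intro (─-⊆ U S′ x x∈) (not-intro (¬true⇒false λ x∈S →
          true≢false (trans (≡-sym (S⊆S′ x x∈S)) (not-elim (∧-snd {U x} x∈)))))

        out′≤1 : ∀ x → x ∈ S → deg G (U ─ S′) x ≤ 1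
        out′≤1 x x∈S = ≤-trans (deg-mono G (U ─ S′) (U ─ S) out′⊆ x) (out≤1 x x∈S)

        S′⊆U : S′ ⊆ U
        S′⊆U x x∈S′ = [ (λ { refl → w∈U }) , S⊆U x ]′ (insert-elim S x∈S′)

        |S′| : count S′ ≡ 4 + c
        |S′| = trans (count-insert S w∉S) (cong suc |S|)

        -- A member of S with a neighbour y ∉ S ∪ {w} is not joined to v′:
        -- otherwise v, of degree n − 3, has a neighbour seeing both y and v′.
        not-joined : ∀ {x y} → x ∈ S → adj G v′ x ≡ true → y ∈ nbrs G (U ─ S′) x → ⊥
        not-joined {x} {y} x∈S v′x y∈ =
          deg<2+c vx (∧-snd {(U ─ S′) y} y∈) (adj-sym G v′x) y≢v′ y≢v v′≢v v≁y v≁v′ (≤-reflexive (≡-sym deg-v))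
          where
          y∈out : y ∈ (U ─ S)
          y∈out = out′⊆ y (∧-fst y∈)
          y∉S : y ∉ S
          y∉S = not-elim (∧-snd {U y} y∈out)
          y≢v′ : y ≢ v′
          y≢v′ refl = true≢false (trans (≡-sym v′∈S) y∉S)
          y≢v : y ≢ v
          y≢v refl = true≢false (trans (≡-sym v∈S) y∉S)
          y≢w : y ≢ w
          y≢w refl = true≢false (trans (≡-sym (cong (_∨ S y) (dec-true (y ≟ y) refl)))
                                       (not-elim (∧-snd {U y} (∧-fst y∈))))
          v≁y : adj G v y ≡ false
          v≁y = ¬true⇒false λ vy → y≢w (escapes-to-w y∈out vy)
          x≢v : x ≢ v
          x≢v refl = true≢false (trans (≡-sym (adj-sym G v′x)) v≁v′)
          vx : adj G v x ≡ true
          vx = v-sees x∈S x≢v (adj⇒≢ G v′x ∘ ≡-sym)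

        W′ : Fin p → ℕ
        W′ = W G U S′

        -- A member of `S` has at most one neighbour outside `S′`, and by `not-joined` a neighbour
        -- of `v′` has none: adjacency to `v′` saves the unit that is added here.
        W′+adj : ∀ x → x ∈ S → W′ x + ⟦ adj G v′ x ⟧ ≤ 3 + c
        W′+adj x x∈S with adj G v′ x in v′x
        ... | false = ≤-trans (≤-reflexive (+-identityʳ _))
                        (≤-trans (+-mono-≤ (Δ x (S⊆U x x∈S)) (out′≤1 x x∈S)) (≤-reflexive (+-comm (2 + c) 1)))
        ... | true  = ≤-trans (≤-reflexive (+-comm (W′ x) 1)) (s≤s
                        (≤-trans (+-mono-≤ (Δ x (S⊆U x x∈S)) no-out) (≤-reflexive (+-identityʳ _))))
          where
          no-out : deg G (U ─ S′) x ≤ 0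
          no-out = ≮⇒≥ λ 1≤ → not-joined x∈S v′x (proj₂ (count>0⇒∃ (nbrs G (U ─ S′) x) 1≤))

        W′-v′ : W′ v′ ≤ deg G Q v′ + 2
        W′-v′ = ≤-trans (+-mono-≤ (≤-trans (≤-reflexive (deg-─ G U S S⊆U v′)) (+-mono-≤ S≤Q (out≤1 v′ v′∈S)))
                                  (out′≤1 v′ v′∈S))
                        (≤-reflexive (+-assoc (deg G Q v′) 1 1))
          where
          S≤Q : deg G S v′ ≤ deg G Q v′
          S≤Q = count-mono (nbrs G S v′) (nbrs G Q v′) λ j j∈ →
            ∧-intro (∈-∖ S (∧-fst j∈) (adj⇒≢ G (∧-snd {S j} j∈) ∘ ≡-sym)) (∧-snd {S j} j∈)

        -- `S′` consists of `Q`, `v′` and `w`. With d = `deg G Q v′`, these are charged at most (2 +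
        -- c)(3 + c) - d, d + 2 and 2(2 + c), and d cancels. Adding d to both sides avoids truncated
        -- subtraction.
        cost : Cost S′ ≤ (4 + c) * (3 + c)
        cost = +-cancelʳ-≤ (deg G Q v′) _ _ (begin
          Cost S′ + deg G Q v′
            ≡⟨ ∑-distrib-+ (λ i → ⟦ S′ i ⟧ * W′ i) (λ i → ⟦ nbrs G Q v′ i ⟧) ⟨
          ∑[ i < p ] (⟦ S′ i ⟧ * W′ i + ⟦ nbrs G Q v′ i ⟧)
            ≤⟨ ∑-mono pointwise ⟩
          ∑[ i < p ] (f i + (g i + h i))
            ≡⟨ trans (∑-distrib-+ f (λ i → g i + h i)) (cong (sum f +_) (∑-distrib-+ g h)) ⟩
          sum f + (sum g + sum h)
            ≡⟨ cong₂ _+_ (≡-sym (*-distribʳ-sum (3 + c) (λ i → ⟦ Q i ⟧))) (cong₂ _+_ (∑-pick v′ (W′ v′)) (∑-pick w (W′ w))) ⟩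
          count Q * (3 + c) + (W′ v′ + W′ w)
            ≡⟨ cong (λ t → t * (3 + c) + (W′ v′ + W′ w)) |Q| ⟩
          (2 + c) * (3 + c) + (W′ v′ + W′ w)
            ≤⟨ +-monoʳ-≤ ((2 + c) * (3 + c)) (+-mono-≤ W′-v′ W′-w) ⟩
          (2 + c) * (3 + c) + ((deg G Q v′ + 2) + ((2 + c) + (2 + c)))
            ≡⟨ arith c (deg G Q v′) ⟩
          (4 + c) * (3 + c) + deg G Q v′ ∎)
          where
          open ≤-Reasoning
          f g h : Fin p → ℕ
          f i = ⟦ Q i ⟧ * (3 + c)
          g i = ⟦ does (i ≟ v′) ⟧ * W′ v′
          h i = ⟦ does (i ≟ w) ⟧ * W′ w
          arith : ∀ c d → (2 + c) * (3 + c) + ((d + 2) + ((2 + c) + (2 + c))) ≡ (4 + c) * (3 + c) + d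
          arith = solve-∀
          |Q| : count Q ≡ 2 + c
          |Q| = suc-injective (trans (≡-sym (count-∖ S v′∈S)) |S|)
          W′-w : W′ w ≤ (2 + c) + (2 + c)
          W′-w = ≤-trans (W≤2deg S′ w) (+-mono-≤ (Δ w w∈U) (Δ w w∈U))
          pointwise : ∀ i → ⟦ S′ i ⟧ * W′ i + ⟦ nbrs G Q v′ i ⟧ ≤ f i + (g i + h i)
          pointwise i with i ≟ w
          ... | yes refl rewrite w∉S = ≤-trans
            (≤-reflexive (+-identityʳ _)) (m≤n+m _ (⟦ does (w ≟ v′) ⟧ * W′ v′))
          ... | no _ with S i in i∈S | i ≟ v′
          ...   | false | _        = z≤n
          ...   | true  | yes refl = ≤-trans (≤-reflexive (+-identityʳ _)) (m≤m+n _ 0)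
          ...   | true  | no _     = ≤-trans
            (≤-reflexive (cong (_+ ⟦ adj G v′ i ⟧) (+-identityʳ (W′ i))))
            (≤-trans (W′+adj i i∈S) (≤-reflexive (≡-sym (trans (+-identityʳ _) (+-identityʳ _)))))

      escape : Reduction
      escape = from (count>0⇒∃ missed (≤-reflexive (≡-sym |missed|)))
        where
        from : ∃[ v′ ] v′ ∈ missed → Reduction
        from (v′ , v′∈) = delete S′ S′⊆U |S′| cost
          where open Missed v′∈

    -- A charge is at most `(2 + c) + 1`. If no member of `S` attains this, `S` can be deleted as it
    -- is; if `v` does, both its degree and its number of outside neighbours are maximal, which is
    -- what `Escape` requires.
    reduce : Reduction
    reduce with any? (λ v → (S v Bool.≟ true) ×-dec (3 + c ≤? W G U S v))
    ... | no none = delete⁻¹ S S⊆U |S| (Cost-bound S (3 + c) (2 + c) |S|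
                      λ v v∈S → ≤-pred (≰⇒> λ W≥ → none (v , v∈S , W≥)))
    ... | yes (v , v∈S , W≥) = from (count>0⇒∃ (nbrs G (U ─ S) v) 1≤out)
      where
      deg-v : deg G U v ≡ 2 + c
      deg-v = ≤-antisym (Δ v (S⊆U v v∈S)) (+-cancelʳ-≤ 1 _ _
        (≤-trans (≤-reflexive (+-comm (2 + c) 1)) (≤-trans W≥ (+-monoʳ-≤ (deg G U v) (out≤1 v v∈S)))))
      1≤out : 1 ≤ out v
      1≤out = +-cancelˡ-≤ (2 + c) _ _
        (≤-trans (≤-reflexive (+-comm (2 + c) 1)) (subst (λ t → 3 + c ≤ t + out v) deg-v W≥))
      from : ∃[ w ] w ∈ nbrs G (U ─ S) v → Reduction
      from (w , w∈) = Escape.escape v∈S deg-v w∈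

  reduction : Reduction
  reduction with any? (λ u → (U u Bool.≟ true) ×-dec (4 + c ≤? deg G U u))
  ... | yes (u , u∈U , hub) = reduce-hub u∈U hub
  ... | no ¬hub with any? (λ u → (U u Bool.≟ true) ×-dec (3 + c ≤? deg G U u))
  ...   | yes (u , u∈U , d≥) = reduce-n-2 Δ u∈U (≤-antisym (Δ u u∈U) d≥)
    where
    Δ : ∀ x → x ∈ U → deg G U x ≤ 3 + c
    Δ x x∈U = ≤-pred (≰⇒> λ d → ¬hub (x , x∈U , d))
  ...   | no ¬d≥3+c with any? (λ u → (U u Bool.≟ true) ×-dec (2 + c ≤? deg G U u))
  ...     | yes (u , u∈U , d≥) = Tight.reduce Δ u∈U (≤-antisym (Δ u u∈U) d≥)
    where
    Δ : ∀ x → x ∈ U → deg G U x ≤ 2 + c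
    Δ x x∈U = ≤-pred (≰⇒> λ d → ¬d≥3+c (x , x∈U , d))
  ...     | no ¬d≥2+c = sparse (∑≤count*bound U (deg G U) (1 + c)
                          λ x x∈U → ≤-pred (≰⇒> λ d → ¬d≥2+c (x , x∈U , d)))

-- The upper bound

E-complete : ∀ {p} (G : Graph p) (U : VSet p) → E G U ≤ count U * (count U ∸ 1)
E-complete G U = ∑≤count*bound U (deg G U) (count U ∸ 1) λ i i∈U →
  ≤-trans (count-mono (nbrs G U i) (U ∖ i)
             (λ j j∈ → ∈-∖ U (∧-fst j∈) (adj⇒≢ G (∧-snd {U j} j∈) ∘ ≡-sym)))
          (≤-reflexive (cong (_∸ 1) (≡-sym (count-∖ U i∈U))))

-- Twice the claimed maximum for k(n − 1) + r vertices, where n = 5 + c, up to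
-- the rounding in the second argument of ⊔.
bound : ℕ → ℕ → ℕ → ℕ
bound c k r = k * ((4 + c) * (3 + c)) + (r * (r ∸ 1) ⊔ ((1 + c) * r ∸ 2 * (4 + c)))

bound-suc : ∀ c k r → bound c k r + (4 + c) * (3 + c) ≡ bound c (suc k) r
bound-suc c k r = trans (+-comm (bound c k r) ((4 + c) * (3 + c))) (≡-sym (+-assoc ((4 + c) * (3 + c)) _ _))

∸-suc-≤ : ∀ a b d → (a + b) ∸ d ≤ a + (b ∸ d)
∸-suc-≤ a b d = ≤-trans (∸-monoˡ-≤ d (+-monoʳ-≤ a (m≤n+m∸n b d)))
  (≤-reflexive (trans (cong (_∸ d) (swap a d (b ∸ d))) (m+n∸m≡n d _)))
  where
  swap : ∀ a d e → a + (d + e) ≡ d + (a + e)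
  swap = solve-∀

-- K_m has m - 1 more edges than K_(m-1), so doubled counts leave room for 2(m - 1). Raising `r` by
-- one increases r(r - 1) by 2r and the linear alternative by at most m - 3, both within that room.
bound-shift : ∀ c k r → suc r ≤ 3 + c →
              bound c k (suc r) + (3 + c) * (2 + c) ≤ bound c (suc k) r
bound-shift c k r r<3+c = begin
  (K + (suc r * r ⊔ ((1 + c) * suc r ∸ 2 * (4 + c)))) + (3 + c) * (2 + c)
    ≤⟨ +-monoˡ-≤ ((3 + c) * (2 + c)) (+-monoʳ-≤ K (⊔-lub small large)) ⟩
  (K + (2 * (3 + c) + g)) + (3 + c) * (2 + c)
    ≡⟨ arith c K g ⟩
  ((4 + c) * (3 + c) + K) + g ∎
  where
  open ≤-Reasoning
  K = k * ((4 + c) * (3 + c))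
  g = r * (r ∸ 1) ⊔ ((1 + c) * r ∸ 2 * (4 + c))
  arith : ∀ c K g → (K + (2 * (3 + c) + g)) + (3 + c) * (2 + c) ≡ ((4 + c) * (3 + c) + K) + g
  arith = solve-∀
  square : ∀ r → suc r * r ≡ 2 * r + r * (r ∸ 1)
  square zero    = refl
  square (suc r) = lem r
    where
    lem : ∀ r → suc (suc r) * suc r ≡ 2 * suc r + suc r * r
    lem = solve-∀
  small : suc r * r ≤ 2 * (3 + c) + g
  small = ≤-trans (≤-reflexive (square r))
    (+-mono-≤ (*-monoʳ-≤ 2 (<⇒≤ r<3+c)) (m≤m⊔n (r * (r ∸ 1)) ((1 + c) * r ∸ 2 * (4 + c))))
  large : (1 + c) * suc r ∸ 2 * (4 + c) ≤ 2 * (3 + c) + g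
  large = ≤-trans (≤-reflexive (cong (_∸ 2 * (4 + c)) (*-suc (1 + c) r)))
    (≤-trans (∸-suc-≤ (1 + c) ((1 + c) * r) (2 * (4 + c)))
      (+-mono-≤ (≤-trans (m≤n+m (1 + c) (5 + c)) (≤-reflexive (lem c)))
                (m≤n⊔m (r * (r ∸ 1)) ((1 + c) * r ∸ 2 * (4 + c)))))
    where
    lem : ∀ c → (5 + c) + (1 + c) ≡ 2 * (3 + c)
    lem = solve-∀

-- The case r = m - 1 of deleting m - 1 vertices: the remainder disappears and the number of full
-- blocks stays. The cost is r(r - 1) for this `r`.
bound-wrap : ∀ c k → bound c k 0 + (3 + c) * (2 + c) ≤ bound c k (3 + c)
bound-wrap c k = ≤-trans
  (≤-reflexive (cong (_+ (3 + c) * (2 + c)) (trans (cong (λ t → K + (t ∸ 2 * (4 + c))) (*-zeroʳ (1 + c))) (+-identityʳ K))))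
  (+-monoʳ-≤ K (m≤m⊔n ((3 + c) * (2 + c)) ((1 + c) * (3 + c) ∸ 2 * (4 + c))))
  where
  K = k * ((4 + c) * (3 + c))

-- A block of m vertices contributes m(m - 3) = m(m - 1) - 2m. One of the `suc k` deficits 2m is the
-- one subtracted in `bound`; the other `k` are given away.
bound-sparse : ∀ c k r → (suc k * (4 + c) + r) * (1 + c) ≤ bound c (suc k) r
bound-sparse c k r = begin
  (suc k * (4 + c) + r) * (1 + c)
    ≡⟨ expand c k r ⟩
  suc k * (4 + c) * (1 + c) + (1 + c) * r
    ≤⟨ +-monoʳ-≤ (suc k * (4 + c) * (1 + c)) (m≤n+m∸n ((1 + c) * r) (2 * (4 + c))) ⟩
  suc k * (4 + c) * (1 + c) + (2 * (4 + c) + ex)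
    ≤⟨ m≤m+n _ (k * (2 * (4 + c))) ⟩
  suc k * (4 + c) * (1 + c) + (2 * (4 + c) + ex) + k * (2 * (4 + c))
    ≡⟨ collect c k ex ⟩
  suc k * ((4 + c) * (3 + c)) + ex
    ≤⟨ +-monoʳ-≤ (suc k * ((4 + c) * (3 + c))) (m≤n⊔m (r * (r ∸ 1)) ex) ⟩
  bound c (suc k) r ∎
  where
  open ≤-Reasoning
  ex : ℕ
  ex = (1 + c) * r ∸ 2 * (4 + c)
  expand : ∀ c k r → (suc k * (4 + c) + r) * (1 + c) ≡ suc k * (4 + c) * (1 + c) + (1 + c) * r
  expand = solve-∀
  collect : ∀ c k e → suc k * (4 + c) * (1 + c) + (2 * (4 + c) + e) + k * (2 * (4 + c))
                      ≡ suc k * ((4 + c) * (3 + c)) + e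
  collect = solve-∀

module Upper {p} c (G : Graph p) (free : ¬ ContainsT2 (5 + c) G) where

  -- The recursion is on `N`, a bound for the size of `U`, because `k` does not decrease when the
  -- remainder wraps around to 0.
  E≤bound : ∀ N U k r → count U ≤ N → r ≤ 3 + c → count U ≡ k * (4 + c) + r → E G U ≤ bound c k r
  E≤bound N U zero r _ _ |U| =
    ≤-trans (E-complete G U) (≤-trans (≤-reflexive (cong (λ t → t * (t ∸ 1)) |U|)) (m≤m⊔n _ _))
  E≤bound zero U (suc k) r |U|≤0 _ |U| =
    contradiction (≤-trans (≤-reflexive (≡-sym |U|)) |U|≤0) λ ()
  E≤bound (suc N) U (suc k) r |U|≤N r≤ |U| = step reduction
    where
    open TFree c G free U

    remaining : ∀ S s {t} → S ⊆ U → count S ≡ s → count U ≡ s + t → count (U ─ S) ≡ t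
    remaining S s {t} S⊆U refl |U|′ =
      +-cancelˡ-≡ (count S) _ _ (trans (≡-sym (count-─ U S S⊆U)) |U|′)

    smaller : ∀ S s → S ⊆ U → count S ≡ suc s → count (U ─ S) ≤ N
    smaller S s S⊆U |S| = ≤-trans (m≤n+m _ s)
      (≤-pred (≤-trans (≤-reflexive (trans (cong (_+ count (U ─ S)) (≡-sym |S|)) (≡-sym (count-─ U S S⊆U)))) |U|≤N))

    |U|′ : count U ≡ (4 + c) + (k * (4 + c) + r)
    |U|′ = trans |U| (+-assoc (4 + c) (k * (4 + c)) r)

    |U|″ : count U ≡ (3 + c) + (k * (4 + c) + suc r)
    |U|″ = trans |U|′ (trans (≡-sym (+-suc (3 + c) _)) (cong (3 + c +_) (≡-sym (+-suc _ r))))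

    step : Reduction → E G U ≤ bound c (suc k) r
    step (sparse E≤) = ≤-trans E≤ (≤-trans (≤-reflexive (cong (_* (1 + c)) |U|)) (bound-sparse c k r))
    step (delete S S⊆U |S| cost) = ≤-trans (≤-reflexive (E-remove G U S S⊆U))
      (≤-trans (+-mono-≤ (E≤bound N (U ─ S) k r (smaller S (3 + c) S⊆U |S|) r≤ (remaining S (4 + c) S⊆U |S| |U|′)) cost)
               (≤-reflexive (bound-suc c k r)))
    step (delete⁻¹ S S⊆U |S| cost) with m≤n⇒m<n∨m≡n r≤
    ... | inj₁ r<3+c = ≤-trans (≤-reflexive (E-remove G U S S⊆U))
      (≤-trans (+-mono-≤ (E≤bound N (U ─ S) k (suc r) (smaller S (2 + c) S⊆U |S|) r<3+c
                                  (remaining S (3 + c) S⊆U |S| |U|″)) cost)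
               (bound-shift c k r r<3+c))
    ... | inj₂ refl = ≤-trans (≤-reflexive (E-remove G U S S⊆U))
      (≤-trans (+-mono-≤ (E≤bound N (U ─ S) (suc k) 0 (smaller S (2 + c) S⊆U |S|) z≤n
                                  (trans (remaining S (3 + c) S⊆U |S| |U|″) (wrap c k))) cost)
               (bound-wrap c (suc k)))
      where
      wrap : ∀ c k → k * (4 + c) + suc (3 + c) ≡ suc k * (4 + c) + 0
      wrap = solve-∀

-- Degree sums and edge counts

degreeSum : ∀ {p} → Graph p → ℕ
degreeSum {p} G = ∑[ i < p ] (∑[ j < p ] ⟦ adj G i j ⟧)

degreeSum≡E : ∀ {p} (G : Graph p) → degreeSum G ≡ E G (λ _ → true)
degreeSum≡E {p} G = sum-cong-≗ {p} (λ i → ≡-sym (*-identityˡ (count (adj G i))))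

sum-allFin : ∀ {p} (f : Fin p → ℕ) → List.sum (List.map f (List.allFin p)) ≡ sum f
sum-allFin {p} f = trans (cong List.sum (List.map-tabulate id f)) (sum-tabulate f)
  where
  sum-tabulate : ∀ {p} (f : Fin p → ℕ) → List.sum (List.tabulate f) ≡ sum f
  sum-tabulate {zero}  f = refl
  sum-tabulate {suc p} f = cong (f zero +_) (sum-tabulate (f ∘ suc))

handshake : ∀ {p} (G : Graph p) → degreeSum G ≡ 2 * edgeCount G
handshake {p} G = begin
  ∑[ i < p ] (∑[ j < p ] ⟦ adj G i j ⟧)
    ≡⟨ sum-cong-≗ (λ i → trans (sum-cong-≗ (λ j → split i j)) (∑-distrib-+ (up i) (λ j → up j i))) ⟩
  ∑[ i < p ] (∑[ j < p ] up i j + ∑[ j < p ] up j i)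
    ≡⟨ ∑-distrib-+ (λ i → ∑[ j < p ] up i j) (λ i → ∑[ j < p ] up j i) ⟩
  e + ∑[ i < p ] (∑[ j < p ] up j i)
    ≡⟨ cong (e +_) (∑-comm (λ i j → up j i)) ⟩
  e + e
    ≡⟨ cong₂ _+_ e≡ (trans e≡ (≡-sym (+-identityʳ _))) ⟩
  2 * edgeCount G ∎
  where
  open ≡-Reasoning
  up : Fin p → Fin p → ℕ
  up i j = if does (i <? j) then (if adj G i j then 1 else 0) else 0
  e : ℕ
  e = ∑[ i < p ] (∑[ j < p ] up i j)
  if≡⟦⟧ : ∀ b → ⟦ b ⟧ ≡ (if b then 1 else 0)
  if≡⟦⟧ true  = refl
  if≡⟦⟧ false = refl
  up-< : ∀ i j → toℕ i < toℕ j → up i j ≡ ⟦ adj G i j ⟧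
  up-< i j i<j = trans (cong (λ b → if b then (if adj G i j then 1 else 0) else 0) (dec-true (i <? j) i<j))
                       (≡-sym (if≡⟦⟧ (adj G i j)))
  up-≮ : ∀ i j → ¬ (toℕ i < toℕ j) → up i j ≡ 0
  up-≮ i j i≮j = cong (λ b → if b then (if adj G i j then 1 else 0) else 0) (dec-false (i <? j) i≮j)
  split : ∀ i j → ⟦ adj G i j ⟧ ≡ up i j + up j i
  split i j with <-cmp (toℕ i) (toℕ j)
  ... | tri< i<j _ j≮i = ≡-sym (trans (cong₂ _+_ (up-< i j i<j) (up-≮ j i j≮i)) (+-identityʳ _))
  ... | tri> i≮j _ j<i = trans (cong ⟦_⟧ (Graph.sym G i j)) (≡-sym (cong₂ _+_ (up-≮ i j i≮j) (up-< j i j<i)))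
  ... | tri≈ i≮j i≡j j≮i with toℕ-injective i≡j
  ...   | refl = trans (cong ⟦_⟧ (irrefl G i)) (≡-sym (cong₂ _+_ (up-≮ i i i≮j) (up-≮ i i i≮j)))
  e≡ : e ≡ edgeCount G
  e≡ = ≡-sym (trans (sum-allFin (λ i → List.sum (List.map (up i) (List.allFin p)))) (sum-cong-≗ (λ i → sum-allFin (up i))))

edges≤bound : ∀ c k r (G : Graph (k * (4 + c) + r)) → r ≤ 3 + c → ¬ ContainsT2 (5 + c) G →
              2 * edgeCount G ≤ bound c k r
edges≤bound c k r G r≤ free =
  subst (_≤ bound c k r) (trans (≡-sym (degreeSum≡E G)) (handshake G))
    (Upper.E≤bound c G free _ (λ _ → true) k r ≤-refl r≤ (count-all (k * (4 + c) + r)))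

-- Disjoint unions

small⇒free : ∀ {p n} (G : Graph p) → p < n → ¬ ContainsT2 n G
small⇒free G p<n (f , f-inj , _) = <⇒≱ p<n (injective⇒≤ f-inj)

lowDegree⇒free : ∀ {p} c (G : Graph p) → (∀ i → count (adj G i) ≤ 1 + c) → ¬ ContainsT2 (5 + c) G
lowDegree⇒free c G low (f , f-inj , f-edge) = <⇒≱ (s≤s (low (f zero)))
  (injection⇒≤count (adj G (f zero)) leaf leaf-adj
    (λ eq → inject≤-injective _ _ _ _ (Fin.suc-injective (f-inj eq))))
  where
  le : 2 + c ≤ 4 + c
  le = m≤n+m (2 + c) 2
  leaf : Fin (2 + c) → Fin _
  leaf i = f (suc (inject≤ i le))
  leaf-adj : ∀ i → leaf i ∈ adj G (f zero)
  leaf-adj i = f-edge zero (suc (inject≤ i le))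
    (inj₁ (refl , s≤s z≤n , ≤-trans (≤-reflexive (cong suc (toℕ-inject≤ i le))) (toℕ<n i)))

complete : ∀ p → Graph p
complete p .adj i j  = not (does (i ≟ j))
complete p .Graph.sym i j with i ≟ j | j ≟ i
... | yes _   | yes _   = refl
... | yes i≡j | no j≢i  = ⊥-elim (j≢i (≡-sym i≡j))
... | no i≢j  | yes j≡i = ⊥-elim (i≢j (≡-sym j≡i))
... | no _    | no _    = refl
complete p .irrefl i = cong not (dec-true (i ≟ i) refl)

degreeSum-complete : ∀ p → degreeSum (complete p) ≡ p * (p ∸ 1)
degreeSum-complete p = trans (sum-cong-≗ row) (∑-const p (p ∸ 1))
  where
  row : ∀ i → ∑[ j < p ] ⟦ not (does (i ≟ j)) ⟧ ≡ p ∸ 1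
  row i = trans (count-cong _ ((λ _ → true) ∖ i) (λ j → Graph.sym (complete p) i j))
    (cong (_∸ 1) (trans (≡-sym (count-∖ {p} (λ _ → true) {i} refl)) (count-all p)))

infixr 6 _⊕_

_⊕_ : ∀ {a b} → Graph a → Graph b → Graph (a + b)
_⊕_ {a} {b} G H = record { adj = λ i j → link (splitAt a i) (splitAt a j)
                         ; sym = λ i j → link-sym (splitAt a i) (splitAt a j)
                         ; irrefl = λ i → link-irrefl (splitAt a i) }
  where
  link : Fin a ⊎ Fin b → Fin a ⊎ Fin b → Bool
  link (inj₁ i) (inj₁ j) = adj G i j
  link (inj₂ i) (inj₂ j) = adj H i j
  link _        _        = false
  link-sym : ∀ s t → link s t ≡ link t s
  link-sym (inj₁ i) (inj₁ j) = Graph.sym G i j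
  link-sym (inj₁ _) (inj₂ _) = refl
  link-sym (inj₂ _) (inj₁ _) = refl
  link-sym (inj₂ i) (inj₂ j) = Graph.sym H i j
  link-irrefl : ∀ s → link s s ≡ false
  link-irrefl (inj₁ i) = irrefl G i
  link-irrefl (inj₂ i) = irrefl H i

side : ∀ a {b} (y : Fin (a + b)) → (∃[ j ] y ≡ j ↑ˡ b) ⊎ (∃[ j ] y ≡ a ↑ʳ j)
side a y with splitAt a y in eq
... | inj₁ j = inj₁ (j , ≡-sym (splitAt⁻¹-↑ˡ eq))
... | inj₂ j = inj₂ (j , ≡-sym (splitAt⁻¹-↑ʳ eq))

module _ {a b} (G : Graph a) (H : Graph b) where

  ⊕-ˡˡ : ∀ i j → adj (G ⊕ H) (i ↑ˡ b) (j ↑ˡ b) ≡ adj G i j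
  ⊕-ˡˡ i j rewrite splitAt-↑ˡ a i b | splitAt-↑ˡ a j b = refl

  ⊕-ʳʳ : ∀ i j → adj (G ⊕ H) (a ↑ʳ i) (a ↑ʳ j) ≡ adj H i j
  ⊕-ʳʳ i j rewrite splitAt-↑ʳ a b i | splitAt-↑ʳ a b j = refl

  ⊕-ˡʳ : ∀ i j → adj (G ⊕ H) (i ↑ˡ b) (a ↑ʳ j) ≡ false
  ⊕-ˡʳ i j rewrite splitAt-↑ˡ a i b | splitAt-↑ʳ a b j = refl

  ⊕-ʳˡ : ∀ i j → adj (G ⊕ H) (a ↑ʳ i) (j ↑ˡ b) ≡ false
  ⊕-ʳˡ i j rewrite splitAt-↑ʳ a b i | splitAt-↑ˡ a j b = refl

  degreeSum-⊕ : degreeSum (G ⊕ H) ≡ degreeSum G + degreeSum H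
  degreeSum-⊕ = trans (∑-↑ a _) (cong₂ _+_ (sum-cong-≗ rowˡ) (sum-cong-≗ rowʳ))
    where
    rowˡ : ∀ i → ∑[ j < a + b ] ⟦ adj (G ⊕ H) (i ↑ˡ b) j ⟧ ≡ ∑[ j < a ] ⟦ adj G i j ⟧
    rowˡ i = trans (∑-↑ a _) (trans
      (cong₂ _+_ (sum-cong-≗ (λ j → cong ⟦_⟧ (⊕-ˡˡ i j))) (∑-zero (λ j → cong ⟦_⟧ (⊕-ˡʳ i j))))
      (+-identityʳ _))
    rowʳ : ∀ i → ∑[ j < a + b ] ⟦ adj (G ⊕ H) (a ↑ʳ i) j ⟧ ≡ ∑[ j < b ] ⟦ adj H i j ⟧
    rowʳ i = trans (∑-↑ a _)
      (cong₂ _+_ (∑-zero (λ j → cong ⟦_⟧ (⊕-ʳˡ i j))) (sum-cong-≗ (λ j → cong ⟦_⟧ (⊕-ʳʳ i j))))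

  ⊕-edgeˡ : ∀ {x y} → adj (G ⊕ H) x y ≡ true → ∃[ i ] x ≡ i ↑ˡ b → ∃[ j ] y ≡ j ↑ˡ b
  ⊕-edgeˡ {y = y} xy (i , refl) with side a y
  ... | inj₁ in-left    = in-left
  ... | inj₂ (j , refl) = contradiction (trans (≡-sym xy) (⊕-ˡʳ i j)) λ ()

  ⊕-edgeʳ : ∀ {x y} → adj (G ⊕ H) x y ≡ true → ∃[ i ] x ≡ a ↑ʳ i → ∃[ j ] y ≡ a ↑ʳ j
  ⊕-edgeʳ {y = y} xy (i , refl) with side a y
  ... | inj₂ in-right   = in-right
  ... | inj₁ (j , refl) = contradiction (trans (≡-sym xy) (⊕-ʳˡ i j)) λ ()

-- `T2Edge` directs every edge away from position 0, so closure along directed edges suffices: first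
-- to positions 1 to n - 3, then from n - 3 to the last two.
T2-connected : ∀ c (P : Fin (5 + c) → Set) → P zero →
               (∀ a b → T2Edge (5 + c) (toℕ a) (toℕ b) → P a → P b) → ∀ b → P b
T2-connected c P P₀ edge = all
  where
  near : ∀ b → toℕ b ≤ 2 + c → P b
  near zero    _ = P₀
  near (suc b) h = edge zero (suc b) (inj₁ (refl , s≤s z≤n , h)) P₀
  hub : Fin (5 + c)
  hub = inject≤ (fromℕ (2 + c)) (m≤n+m (3 + c) 2)
  hub≡ : toℕ hub ≡ 2 + c
  hub≡ = trans (toℕ-inject≤ (fromℕ (2 + c)) (m≤n+m (3 + c) 2)) (toℕ-fromℕ (2 + c))
  P-hub : P hub
  P-hub = near hub (≤-reflexive hub≡)
  all : ∀ b → P b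
  all b with toℕ b ≤? 2 + c
  ... | yes h = near b h
  ... | no h with m≤n⇒m<n∨m≡n (≰⇒> h)
  ...   | inj₂ 3+c≡b = edge hub b (inj₂ (hub≡ , inj₁ (≡-sym 3+c≡b))) P-hub
  ...   | inj₁ 3+c<b = edge hub b (inj₂ (hub≡ , inj₂ (≤-antisym (≤-pred (toℕ<n b)) 3+c<b))) P-hub

pullback : ∀ {p q n} (G : Graph p) (H : Graph q) (ι : Fin p → Fin q) →
           (∀ i j → adj H (ι i) (ι j) ≡ adj G i j) →
           (T : ContainsT2 n H) → (∀ a → ∃[ i ] proj₁ T a ≡ ι i) → ContainsT2 n G
pullback {n = n} G H ι ι-adj (f , f-inj , f-edge) lies = g , g-inj , g-edge
  where
  g : Fin n → Fin _
  g a = proj₁ (lies a)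
  f≡ : ∀ a → f a ≡ ι (g a)
  f≡ a = proj₂ (lies a)
  g-inj : ∀ {a b} → g a ≡ g b → a ≡ b
  g-inj {a} {b} eq = f-inj (trans (f≡ a) (trans (cong ι eq) (≡-sym (f≡ b))))
  g-edge : ∀ a b → T2Edge n (toℕ a) (toℕ b) → adj G (g a) (g b) ≡ true
  g-edge a b e = trans (≡-sym (ι-adj (g a) (g b)))
                   (trans (≡-sym (cong₂ (adj H) (f≡ a) (f≡ b))) (f-edge a b e))

⊕-free : ∀ {a b} c (G : Graph a) (H : Graph b) →
         ¬ ContainsT2 (5 + c) G → ¬ ContainsT2 (5 + c) H → ¬ ContainsT2 (5 + c) (G ⊕ H)
⊕-free {a} {b} c G H G-free H-free T@(f , _ , f-edge) with side a (f zero)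
... | inj₁ left = G-free (pullback G (G ⊕ H) (_↑ˡ b) (⊕-ˡˡ G H) T
  (T2-connected c (λ x → ∃[ i ] f x ≡ i ↑ˡ b) left λ x y e → ⊕-edgeˡ G H (f-edge x y e)))
... | inj₂ right = H-free (pullback H (G ⊕ H) (a ↑ʳ_) (⊕-ʳʳ G H) T
  (T2-connected c (λ x → ∃[ i ] f x ≡ a ↑ʳ i) right λ x y e → ⊕-edgeʳ G H (f-edge x y e)))

-- Defined by recursion so that `cliques` has the type produced by `_⊕_` definitionally; `attained`
-- transports to `p` at the end.
cliquesSize : ℕ → ℕ → ℕ → ℕ
cliquesSize c zero    q = q
cliquesSize c (suc k) q = (4 + c) + cliquesSize c k q

cliquesSize≡ : ∀ c k q → cliquesSize c k q ≡ k * (4 + c) + q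
cliquesSize≡ c zero    q = refl
cliquesSize≡ c (suc k) q = trans (cong (4 + c +_) (cliquesSize≡ c k q)) (≡-sym (+-assoc (4 + c) (k * (4 + c)) q))

cliques : ∀ c k {q} → Graph q → Graph (cliquesSize c k q)
cliques c zero    H = H
cliques c (suc k) H = complete (4 + c) ⊕ cliques c k H

cliques-free : ∀ c k {q} (H : Graph q) → ¬ ContainsT2 (5 + c) H → ¬ ContainsT2 (5 + c) (cliques c k H)
cliques-free c zero    H H-free = H-free
cliques-free c (suc k) H H-free =
  ⊕-free c (complete (4 + c)) (cliques c k H) (small⇒free (complete (4 + c)) ≤-refl) (cliques-free c k H H-free)

degreeSum-cliques : ∀ c k {q} (H : Graph q) →
                    degreeSum (cliques c k H) ≡ k * ((4 + c) * (3 + c)) + degreeSum H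
degreeSum-cliques c zero    H = refl
degreeSum-cliques c (suc k) H = trans (degreeSum-⊕ (complete (4 + c)) (cliques c k H))
  (trans (cong₂ _+_ (degreeSum-complete (4 + c)) (degreeSum-cliques c k H))
         (≡-sym (+-assoc ((4 + c) * (3 + c)) _ _)))

-- Near-regular graphs

<ᵇ-elim : ∀ {m n} → (m <ᵇ n) ≡ true → m < n
<ᵇ-elim {m} {n} h = <ᵇ⇒< m n (Equivalence.from T-≡ h)

≡ᵇ-elim : ∀ {m n} → (m ≡ᵇ n) ≡ true → m ≡ n
≡ᵇ-elim {m} {n} h = ≡ᵇ⇒≡ m n (Equivalence.from T-≡ h)

∑-last : ∀ q (f : ℕ → ℕ) → ∑[ j < suc q ] f (toℕ j) ≡ ∑[ j < q ] f (toℕ j) + f q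
∑-last q f = trans (sum-init-last (λ j → f (toℕ j)))
  (cong₂ _+_ (sum-cong-≗ {q} (λ j → cong f (toℕ-inject₁ j))) (cong f (toℕ-fromℕ q)))

∑-reverse : ∀ q (f : ℕ → ℕ) → ∑[ j < q ] f (q ∸ toℕ j) ≡ ∑[ j < q ] f (suc (toℕ j))
∑-reverse zero    f = refl
∑-reverse (suc q) f = begin
  f (suc q) + ∑[ j < q ] f (q ∸ toℕ j)      ≡⟨ cong (f (suc q) +_) (∑-reverse q f) ⟩
  f (suc q) + ∑[ j < q ] f (suc (toℕ j))    ≡⟨ +-comm (f (suc q)) _ ⟩
  ∑[ j < q ] f (suc (toℕ j)) + f (suc q)    ≡⟨ ∑-last q (f ∘ suc) ⟨
  ∑[ j < suc q ] f (suc (toℕ j))            ∎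
  where open ≡-Reasoning

-- A function of the distance that is symmetric about q/2 sums, around the
-- cycle of length q, to the same value from every starting point.
∑-distance : ∀ q (f : ℕ → ℕ) → (∀ t → t < q → f (suc t) ≡ f (q ∸ t)) →
             ∀ i → i ≤ q → ∑[ j < suc q ] f ∣ i - toℕ j ∣ ≡ ∑[ j < suc q ] f (toℕ j)
∑-distance q f symm zero    _   = refl
-- Lowering the starting point by one turns the term at 0 into the term at `q`; the symmetry of `f`
-- makes them equal.
∑-distance q f symm (suc i) i<q = begin
  f (suc i) + ∑[ j < q ] f ∣ i - toℕ j ∣      ≡⟨ +-comm (f (suc i)) _ ⟩
  ∑[ j < q ] f ∣ i - toℕ j ∣ + f (suc i)      ≡⟨ cong (∑[ j < q ] f ∣ i - toℕ j ∣ +_)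
                                                   (trans (symm i i<q) (cong f (≡-sym (m≤n⇒∣m-n∣≡n∸m (<⇒≤ i<q))))) ⟩
  ∑[ j < q ] f ∣ i - toℕ j ∣ + f ∣ i - q ∣    ≡⟨ ∑-last q (λ t → f ∣ i - t ∣) ⟨
  ∑[ j < suc q ] f ∣ i - toℕ j ∣              ≡⟨ ∑-distance q f symm i (<⇒≤ i<q) ⟩
  ∑[ j < suc q ] f (toℕ j)                    ∎
  where open ≡-Reasoning

count-<ᵇ : ∀ q d → d ≤ q → ∑[ j < q ] ⟦ toℕ j <ᵇ d ⟧ ≡ d
count-<ᵇ q       zero    _         = ∑-zero {q} (λ _ → refl)
count-<ᵇ (suc q) (suc d) (s≤s d≤q) = cong suc (count-<ᵇ q d d≤q)

count-≡ᵇ : ∀ q x → x < q → ∑[ j < q ] ⟦ toℕ j ≡ᵇ x ⟧ ≡ 1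
count-≡ᵇ (suc q) zero    _         = cong suc (∑-zero {q} (λ _ → refl))
count-≡ᵇ (suc q) (suc x) (s≤s x<q) = count-≡ᵇ q x x<q

count-≡ᵇ-≤ : ∀ q x → ∑[ j < q ] ⟦ toℕ j ≡ᵇ x ⟧ ≤ 1
count-≡ᵇ-≤ zero    x       = z≤n
count-≡ᵇ-≤ (suc q) zero    = ≤-reflexive (count-≡ᵇ (suc q) zero (s≤s z≤n))
count-≡ᵇ-≤ (suc q) (suc x) = count-≡ᵇ-≤ q x

∨-disjoint : ∀ {a b} → (a ≡ true → b ≡ true → ⊥) → ⟦ a ∨ b ⟧ ≡ ⟦ a ⟧ + ⟦ b ⟧
∨-disjoint {true}  {true}  h = ⊥-elim (h refl refl)
∨-disjoint {true}  {false} h = refl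
∨-disjoint {false} {_}     h = refl

∨-false : ∀ {a b} → a ≡ false → b ≡ false → a ∨ b ≡ false
∨-false refl refl = refl

-- The circulant graph of all cyclic distances at most d on suc q vertices, to
-- which the matching i ~ h + i (i < h) is added when β is true.
module NearRegular (q d h : ℕ) (d<h : d < h) (2h≤1+q : h + h ≤ suc q) (β : Bool) where

  close : ℕ → Bool
  close t = (0 <ᵇ t) ∧ (t <ᵇ suc d)

  cyclicallyClose : ℕ → Bool
  cyclicallyClose t = close t ∨ close (suc q ∸ t)

  halfMatch match : ℕ → ℕ → Bool
  halfMatch i j = (i <ᵇ h) ∧ (j ≡ᵇ i + h)
  match i j = halfMatch i j ∨ halfMatch j i

  close-≤ : ∀ {t} → close t ≡ true → t ≤ d
  close-≤ {t} c = ≤-pred (<ᵇ-elim (∧-snd {0 <ᵇ t} c))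

  close-far : ∀ {t} → d < t → close t ≡ false
  close-far d<t = ¬true⇒false λ c → <⇒≱ d<t (close-≤ c)

  d<1+q : d < suc q
  d<1+q = <-≤-trans d<h (≤-trans (m≤m+n h h) 2h≤1+q)

  halfMatch-elim : ∀ {i j} → halfMatch i j ≡ true → i < h × j ≡ i + h
  halfMatch-elim {i} {j} m = <ᵇ-elim (∧-fst m) , ≡ᵇ-elim (∧-snd {i <ᵇ h} m)

  halfMatch-irrefl : ∀ i → halfMatch i i ≡ false
  halfMatch-irrefl i = ¬true⇒false λ m → let i<h , i≡i+h = halfMatch-elim m in
    <⇒≱ i<h (≤-trans (m≤n+m h i) (≤-reflexive (≡-sym i≡i+h)))

  graph : Graph (suc q)
  graph .adj i j = cyclicallyClose ∣ toℕ i - toℕ j ∣ ∨ (β ∧ match (toℕ i) (toℕ j))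
  graph .Graph.sym i j = cong₂ _∨_ (cong cyclicallyClose (∣-∣-comm (toℕ i) (toℕ j)))
    (cong (β ∧_) (∨-comm (halfMatch (toℕ i) (toℕ j)) (halfMatch (toℕ j) (toℕ i))))
  graph .irrefl i = ∨-false
    (trans (cong cyclicallyClose (∣n-n∣≡0 (toℕ i))) (close-far d<1+q))
    (trans (cong (β ∧_) (∨-false (halfMatch-irrefl (toℕ i)) (halfMatch-irrefl (toℕ i)))) (∧-zeroʳ β))

  circulantDegree : ∀ (i : Fin (suc q)) → ∑[ j < suc q ] ⟦ cyclicallyClose ∣ toℕ i - toℕ j ∣ ⟧ ≡ d + d
  circulantDegree i = begin
    ∑[ j < suc q ] ⟦ cyclicallyClose ∣ toℕ i - toℕ j ∣ ⟧
      ≡⟨ ∑-distance q (⟦_⟧ ∘ cyclicallyClose) symm (toℕ i) (≤-pred (toℕ<n i)) ⟩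
    ∑[ j < suc q ] ⟦ cyclicallyClose (toℕ j) ⟧
      ≡⟨ trans (sum-cong-≗ (λ j → ∨-disjoint (disjoint j)))
               (∑-distrib-+ {suc q} (λ j → ⟦ close (toℕ j) ⟧) (λ j → ⟦ close (suc q ∸ toℕ j) ⟧)) ⟩
    ∑[ j < suc q ] ⟦ close (toℕ j) ⟧ + ∑[ j < suc q ] ⟦ close (suc q ∸ toℕ j) ⟧
      ≡⟨ cong₂ _+_ (count-<ᵇ q d (≤-pred d<1+q))
                   (trans (∑-reverse (suc q) (⟦_⟧ ∘ close)) (count-<ᵇ (suc q) d (<⇒≤ d<1+q))) ⟩
    d + d ∎
    where
    open ≡-Reasoning
    symm : ∀ t → t < q → ⟦ cyclicallyClose (suc t) ⟧ ≡ ⟦ cyclicallyClose (q ∸ t) ⟧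
    symm t t<q = cong ⟦_⟧ (trans (∨-comm (close (suc t)) (close (q ∸ t)))
      (cong (λ s → close (q ∸ t) ∨ close s) (≡-sym (m∸[m∸n]≡n {suc q} {suc t} (s≤s (<⇒≤ t<q))))))
    disjoint : ∀ (j : Fin (suc q)) → close (toℕ j) ≡ true → close (suc q ∸ toℕ j) ≡ true → ⊥
    disjoint j c c′ = <⇒≱ (+-mono-<-≤ d<h (<⇒≤ d<h))
      (≤-trans 2h≤1+q (≤-trans (m≤n+m∸n (suc q) (toℕ j)) (+-mono-≤ (close-≤ {toℕ j} c) (close-≤ {suc q ∸ toℕ j} c′))))

  matchDegree : ∀ i → i ≤ q → ∑[ j < suc q ] ⟦ match i (toℕ j) ⟧ ≤ 1
  matchDegree i i≤q with i <ᵇ h in i<h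
  ... | true  = ≤-trans (∑-mono λ j → ⟦⟧-mono (to j)) (count-≡ᵇ-≤ (suc q) (i + h))
    where
    to : ∀ (j : Fin (suc q)) → ((toℕ j ≡ᵇ i + h) ∨ halfMatch (toℕ j) i) ≡ true → (toℕ j ≡ᵇ i + h) ≡ true
    to j m with toℕ j ≡ᵇ i + h
    ... | true  = refl
    ... | false = ⊥-elim (<⇒≱ (<ᵇ-elim i<h)
      (≤-trans (m≤n+m h (toℕ j)) (≤-reflexive (≡-sym (proj₂ (halfMatch-elim {toℕ j} {i} m))))))
  ... | false = ≤-trans (∑-mono λ j → ⟦⟧-mono (to j)) (count-≡ᵇ-≤ (suc q) (i ∸ h))
    where
    to : ∀ (j : Fin (suc q)) → halfMatch (toℕ j) i ≡ true → (toℕ j ≡ᵇ i ∸ h) ≡ true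
    to j m = Equivalence.to T-≡ (≡⇒≡ᵇ (toℕ j) (i ∸ h)
      (≡-sym (trans (cong (_∸ h) (proj₂ (halfMatch-elim {toℕ j} {i} m))) (m+n∸n≡m (toℕ j) h))))

  degree-split : ∀ (i : Fin (suc q)) →
                 count (adj graph i) ≡ (d + d) + ∑[ j < suc q ] ⟦ β ∧ match (toℕ i) (toℕ j) ⟧
  degree-split i = trans
    (trans (sum-cong-≗ (λ j → ∨-disjoint (disjoint j)))
           (∑-distrib-+ {suc q} (λ j → ⟦ cyclicallyClose ∣ toℕ i - toℕ j ∣ ⟧) (λ j → ⟦ β ∧ match (toℕ i) (toℕ j) ⟧)))
    (cong (_+ ∑[ j < suc q ] ⟦ β ∧ match (toℕ i) (toℕ j) ⟧) (circulantDegree i))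
    where
    -- Matched vertices are at distance `h`, and both `h` and `suc q ∸ h ≥ h` exceed `d`, so the
    -- matching adds only new edges.
    far : cyclicallyClose h ≡ false
    far = ∨-false (close-far d<h) (close-far (<-≤-trans d<h
      (≤-trans (≤-reflexive (≡-sym (m+n∸n≡m h h))) (∸-monoˡ-≤ h 2h≤1+q))))
    half : ∀ a b → halfMatch a b ≡ true → ∣ a - b ∣ ≡ h
    half a b m = trans (cong (∣ a -_∣) (proj₂ (halfMatch-elim m))) (∣m-m+n∣≡n a h)
    distance : ∀ a b → match a b ≡ true → ∣ a - b ∣ ≡ h
    distance a b m with halfMatch a b in eq
    ... | true  = half a b eq
    ... | false = trans (∣-∣-comm a b) (half b a m)
    disjoint : ∀ (j : Fin (suc q)) → cyclicallyClose ∣ toℕ i - toℕ j ∣ ≡ true →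
               (β ∧ match (toℕ i) (toℕ j)) ≡ true → ⊥
    disjoint j c m = true≢false (trans (≡-sym c)
      (trans (cong cyclicallyClose (distance (toℕ i) (toℕ j) (∧-snd {β} m))) far))

  degree-≤ : ∀ i → count (adj graph i) ≤ (d + d) + ⟦ β ⟧
  degree-≤ i = ≤-trans (≤-reflexive (degree-split i)) (+-monoʳ-≤ (d + d) (extra β))
    where
    extra : ∀ β → ∑[ j < suc q ] ⟦ β ∧ match (toℕ i) (toℕ j) ⟧ ≤ ⟦ β ⟧
    extra true  = matchDegree (toℕ i) (≤-pred (toℕ<n i))
    extra false = ≤-reflexive (∑-zero {suc q} (λ _ → refl))

  matchTotal : ∑[ i < suc q ] (∑[ j < suc q ] ⟦ match (toℕ i) (toℕ j) ⟧) ≡ h + h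
  matchTotal = begin
    ∑[ i < suc q ] (∑[ j < suc q ] ⟦ match (toℕ i) (toℕ j) ⟧)
      ≡⟨ sum-cong-≗ (λ i → trans (sum-cong-≗ {suc q} (λ j → ∨-disjoint (disjoint (toℕ i) (toℕ j)))) (∑-distrib-+ {suc q} (hm i) (λ j → hm j i))) ⟩
    ∑[ i < suc q ] (∑[ j < suc q ] hm i j + ∑[ j < suc q ] hm j i)
      ≡⟨ ∑-distrib-+ {suc q} (λ i → ∑[ j < suc q ] hm i j) (λ i → ∑[ j < suc q ] hm j i) ⟩
    ∑[ i < suc q ] (∑[ j < suc q ] hm i j) + ∑[ i < suc q ] (∑[ j < suc q ] hm j i)
      ≡⟨ cong₂ _+_ total (trans (∑-comm (λ i j → hm j i)) total) ⟩
    h + h ∎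
    where
    open ≡-Reasoning
    hm : Fin (suc q) → Fin (suc q) → ℕ
    hm i j = ⟦ halfMatch (toℕ i) (toℕ j) ⟧
    disjoint : ∀ a b → halfMatch a b ≡ true → halfMatch b a ≡ true → ⊥
    disjoint a b m m′ = <⇒≱ (proj₁ (halfMatch-elim {a} {b} m))
      (≤-trans (m≤n+m h b) (≤-reflexive (≡-sym (proj₂ (halfMatch-elim {b} {a} m′)))))
    row : ∀ i → ∑[ j < suc q ] hm i j ≡ ⟦ toℕ i <ᵇ h ⟧
    row i with toℕ i <ᵇ h in i<h
    ... | true  = count-≡ᵇ (suc q) (toℕ i + h) (<-≤-trans (+-monoˡ-< h (<ᵇ-elim i<h)) 2h≤1+q)
    ... | false = ∑-zero {suc q} (λ _ → refl)
    total : ∑[ i < suc q ] (∑[ j < suc q ] hm i j) ≡ h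
    total = trans (sum-cong-≗ row) (count-<ᵇ (suc q) h (≤-trans (m≤m+n h h) 2h≤1+q))

  degreeSum≡ : degreeSum graph ≡ suc q * (d + d) + ⟦ β ⟧ * (h + h)
  degreeSum≡ = trans (sum-cong-≗ degree-split)
    (trans (∑-distrib-+ {suc q} (λ _ → d + d) (λ i → ∑[ j < suc q ] ⟦ β ∧ match (toℕ i) (toℕ j) ⟧))
           (cong₂ _+_ (∑-const (suc q) (d + d)) (extra β)))
    where
    extra : ∀ β → ∑[ i < suc q ] (∑[ j < suc q ] ⟦ β ∧ match (toℕ i) (toℕ j) ⟧) ≡ ⟦ β ⟧ * (h + h)
    extra true  = trans matchTotal (≡-sym (+-identityʳ _))
    extra false = ∑-zero {suc q} (λ i → ∑-zero {suc q} (λ j → refl))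

halve : ∀ n → ∃[ d ] ∃[ β ] n ≡ (d + d) + ⟦ β ⟧
halve zero    = 0 , false , refl
halve (suc n) with halve n
... | d , false , refl = d , true , ≡-sym (+-suc (d + d) 0)
... | d , true  , refl = suc d , false , lem d
  where
  lem : ∀ d → suc ((d + d) + 1) ≡ (suc d + suc d) + 0
  lem = solve-∀

-- The matching is used when `D` is odd. If `q` is odd too, it leaves one vertex uncovered, which
-- accounts for the `suc`. `2 + D ≤ q` puts half of `D` strictly below half of `q`, rounded down.
nearRegular : ∀ q D → 2 + D ≤ q → Σ (Graph q) λ G → (∀ i → count (adj G i) ≤ D) × q * D ≤ suc (degreeSum G)
nearRegular (suc q) D 2+D≤q with halve D | halve (suc q)
... | d , β , refl | h , β′ , 1+q≡ =
  graph , degree-≤ , ≤-trans (≤-reflexive (*-distribˡ-+ (suc q) (d + d) ⟦ β ⟧))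
    (≤-trans (+-monoʳ-≤ (suc q * (d + d)) (extra β)) (≤-reflexive (trans (+-suc _ _) (cong suc (≡-sym degreeSum≡)))))
  where
  d<h : d < h
  d<h = ≰⇒> λ h≤d → <⇒≱ {suc q} (≤-<-trans
    (≤-trans (≤-reflexive 1+q≡) (+-mono-≤ (+-mono-≤ h≤d h≤d) (⟦⟧≤1 β′)))
    (≤-trans (≤-reflexive (cong suc (+-comm (d + d) 1))) (s≤s (s≤s (m≤m+n (d + d) ⟦ β ⟧))))) 2+D≤q
  2h≤1+q : h + h ≤ suc q
  2h≤1+q = ≤-trans (m≤m+n (h + h) ⟦ β′ ⟧) (≤-reflexive (≡-sym 1+q≡))
  open NearRegular q d h d<h 2h≤1+q β
  extra : ∀ β → suc q * ⟦ β ⟧ ≤ suc (⟦ β ⟧ * (h + h))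
  extra false = ≤-trans (≤-reflexive (*-zeroʳ (suc q))) z≤n
  extra true  = ≤-trans (≤-reflexive (*-identityʳ (suc q))) (≤-trans (≤-reflexive 1+q≡)
    (≤-trans (+-monoʳ-≤ (h + h) (⟦⟧≤1 β′)) (≤-reflexive (trans (+-comm (h + h) 1) (cong suc (≡-sym (+-identityʳ _)))))))

-- The two values

2*m≤n⇒m≤n/2 : ∀ {m n} → 2 * m ≤ n → m ≤ n / 2
2*m≤n⇒m≤n/2 {m} {n} h = ≤-trans (≤-reflexive (≡-sym (m*n/n≡m m 2)))
  (/-monoˡ-≤ 2 (≤-trans (≤-reflexive (*-comm m 2)) h))

n≤1+2*m⇒n/2≤m : ∀ {m n} → n ≤ suc (2 * m) → n / 2 ≤ m
n≤1+2*m⇒n/2≤m {m} {n} h = ≤-pred (*-cancelʳ-< 2 (n / 2) (suc m)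
  (≤-trans (s≤s (≤-trans (m/n*n≤m n 2) h)) (≤-reflexive (cong (2 +_) (*-comm 2 m)))))

module _ (c k r : ℕ) (r≤ : r ≤ 3 + c) where

  private
    p n : ℕ
    p = suc k * (4 + c) + r
    n = 5 + c
    K : ℕ
    K = suc k * ((4 + c) * (3 + c))

  valB-numerator : (n ∸ 2) * p ∸ r * (n ∸ 1 ∸ r) ≡ K + r * (r ∸ 1)
  valB-numerator = trans (cong (_∸ r * (4 + c ∸ r)) eq) (m+n∸n≡m (K + r * (r ∸ 1)) (r * (4 + c ∸ r)))
    where
    pred-split : ∀ r → r ≤ 3 + c → r * (3 + c) ≡ r * (r ∸ 1) + r * (4 + c ∸ r)
    pred-split zero    _  = refl
    pred-split (suc r) r< = trans (cong (suc r *_) (≡-sym (m+[n∸m]≡n (<⇒≤ r<)))) (*-distribˡ-+ (suc r) r (3 + c ∸ r))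
    expand : ∀ c k r → (3 + c) * (suc k * (4 + c) + r) ≡ suc k * ((4 + c) * (3 + c)) + r * (3 + c)
    expand = solve-∀
    eq : (3 + c) * p ≡ (K + r * (r ∸ 1)) + r * (4 + c ∸ r)
    eq = trans (expand c k r) (trans (cong (K +_) (pred-split r r≤)) (≡-sym (+-assoc K _ _)))

  ≤valB : ∀ e → 2 * e ≤ K + r * (r ∸ 1) → e ≤ valB p n r
  ≤valB e h = 2*m≤n⇒m≤n/2 (≤-trans h (≤-reflexive (≡-sym valB-numerator)))

  valB≤ : ∀ e → K + r * (r ∸ 1) ≤ 2 * e → valB p n r ≤ e
  valB≤ e h = n≤1+2*m⇒n/2≤m (≤-trans (≤-reflexive valB-numerator) (≤-trans h (n≤1+n _)))

  ≤valA : ∀ e → 2 * e + 2 * (4 + c) ≤ K + (1 + c) * r → e ≤ valA p n r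
  ≤valA e h = m+n≤o⇒m≤o∸n e (2*m≤n⇒m≤n/2 (begin
    2 * (e + (4 + c + r))                ≡⟨ regroup c e r ⟩
    (2 * e + 2 * (4 + c)) + 2 * r        ≤⟨ +-monoˡ-≤ (2 * r) h ⟩
    (K + (1 + c) * r) + 2 * r            ≡⟨ collect c k r ⟩
    (3 + c) * p                          ∎))
    where
    open ≤-Reasoning
    regroup : ∀ c e r → 2 * (e + (4 + c + r)) ≡ (2 * e + 2 * (4 + c)) + 2 * r
    regroup = solve-∀
    collect : ∀ c k r → (suc k * ((4 + c) * (3 + c)) + (1 + c) * r) + 2 * r ≡ (3 + c) * (suc k * (4 + c) + r)
    collect = solve-∀

  -- The `suc` is the unit lost by rounding down in `valA`; it matches the unit that `nearRegular`
  -- may lose.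
  valA≤ : ∀ e → K + (1 + c) * r ≤ suc (2 * e + 2 * (4 + c)) → valA p n r ≤ e
  valA≤ e h = ≤-trans (∸-monoˡ-≤ (4 + c + r) (n≤1+2*m⇒n/2≤m {e + (4 + c + r)} (begin
    (3 + c) * p                              ≡⟨ collect c k r ⟩
    (K + (1 + c) * r) + 2 * r                ≤⟨ +-monoˡ-≤ (2 * r) h ⟩
    suc (2 * e + 2 * (4 + c)) + 2 * r        ≡⟨ regroup c e r ⟩
    suc (2 * (e + (4 + c + r)))              ∎)))
    (≤-reflexive (m+n∸n≡m e (4 + c + r)))
    where
    open ≤-Reasoning
    regroup : ∀ c e r → suc (2 * e + 2 * (4 + c)) + 2 * r ≡ suc (2 * (e + (4 + c + r)))
    regroup = solve-∀
    collect : ∀ c k r → (3 + c) * (suc k * (4 + c) + r) ≡ (suc k * ((4 + c) * (3 + c)) + (1 + c) * r) + 2 * r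
    collect = solve-∀

  bound⇒≤max : ∀ e → 2 * e ≤ bound c (suc k) r → e ≤ valA p n r ⊔ valB p n r
  bound⇒≤max e h with ⊔-sel (r * (r ∸ 1)) ((1 + c) * r ∸ 2 * (4 + c)) | 2 * (4 + c) ≤? (1 + c) * r
  ... | inj₁ max≡ | _ =
    ≤-trans (≤valB e (subst (λ t → 2 * e ≤ K + t) max≡ h)) (m≤n⊔m (valA p n r) (valB p n r))
  -- The truncated difference is 0, so `2 * e ≤ K`, which is already covered by `valB`.
  ... | inj₂ max≡ | no small =
    ≤-trans (≤valB e (≤-trans (subst (λ t → 2 * e ≤ K + t) (trans max≡ (m≤n⇒m∸n≡0 (<⇒≤ (≰⇒> small)))) h) (+-monoʳ-≤ K z≤n)))
            (m≤n⊔m (valA p n r) (valB p n r))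
  ... | inj₂ max≡ | yes large = ≤-trans (≤valA e (begin
    2 * e + 2 * (4 + c)                                      ≤⟨ +-monoˡ-≤ (2 * (4 + c)) (subst (λ t → 2 * e ≤ K + t) max≡ h) ⟩
    (K + ((1 + c) * r ∸ 2 * (4 + c))) + 2 * (4 + c)          ≡⟨ +-assoc K _ _ ⟩
    K + (((1 + c) * r ∸ 2 * (4 + c)) + 2 * (4 + c))          ≡⟨ cong (K +_) (m∸n+n≡m large) ⟩
    K + (1 + c) * r                                          ∎))
    (m≤m⊔n (valA p n r) (valB p n r))
    where open ≤-Reasoning

  -- An inequality is enough: a construction with at least `e` edges has exactly the maximum once
  -- the upper bound is applied.
  Attained : ℕ → Set
  Attained e = Σ (Graph p) λ G → ¬ ContainsT2 n G × e ≤ edgeCount G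

  attained : ∀ {q} (G : Graph q) e → q ≡ p → ¬ ContainsT2 n G → (∀ d → degreeSum G ≡ 2 * d → e ≤ d) → Attained e
  attained G e refl free h = G , free , h (edgeCount G) (handshake G)

  valB-attained : Attained (valB p n r)
  valB-attained = attained (cliques c (suc k) (complete r)) (valB p n r) (cliquesSize≡ c (suc k) r)
    (cliques-free c (suc k) (complete r) (small⇒free (complete r) (s≤s (≤-trans r≤ (n≤1+n _)))))
    (λ d eq → valB≤ d (≤-reflexive (trans
      (trans (cong (K +_) (≡-sym (degreeSum-complete r))) (≡-sym (degreeSum-cliques c (suc k) (complete r)))) eq)))

  valA-attained : Attained (valA p n r)
  valA-attained with nearRegular (4 + c + r) (1 + c) (≤-trans (n≤1+n _) (m≤m+n (4 + c) r))
  ... | H , low , dense = attained (cliques c k H) (valA p n r)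
    (trans (cliquesSize≡ c k (4 + c + r)) (size c k r))
    (cliques-free c k H (lowDegree⇒free c H low))
    (λ d eq → valA≤ d (begin
      K + (1 + c) * r                                           ≡⟨ regroup c k r ⟩
      k * ((4 + c) * (3 + c)) + (4 + c + r) * (1 + c) + 2 * (4 + c)
        ≤⟨ +-monoˡ-≤ (2 * (4 + c)) (≤-trans (+-monoʳ-≤ (k * ((4 + c) * (3 + c))) dense) (≤-reflexive (+-suc _ (degreeSum H)))) ⟩
      suc (k * ((4 + c) * (3 + c)) + degreeSum H) + 2 * (4 + c)  ≡⟨ cong (λ t → suc t + 2 * (4 + c)) (trans (≡-sym (degreeSum-cliques c k H)) eq) ⟩
      suc (2 * d + 2 * (4 + c))                                  ∎))
    where
    open ≤-Reasoning
    size : ∀ c k r → k * (4 + c) + (4 + c + r) ≡ suc k * (4 + c) + r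
    size = solve-∀
    regroup : ∀ c k r → suc k * ((4 + c) * (3 + c)) + (1 + c) * r
                        ≡ k * ((4 + c) * (3 + c)) + (4 + c + r) * (1 + c) + 2 * (4 + c)
    regroup = solve-∀

  extremal : IsExT2 p n (valA p n r ⊔ valB p n r)
  extremal = witness max-attained , upper
    where
    upper : ∀ G → ¬ ContainsT2 n G → edgeCount G ≤ valA p n r ⊔ valB p n r
    upper G free = bound⇒≤max (edgeCount G) (edges≤bound c (suc k) r G r≤ free)
    max-attained : Attained (valA p n r ⊔ valB p n r)
    max-attained with ⊔-sel (valA p n r) (valB p n r)
    ... | inj₁ eq = subst Attained (≡-sym eq) valA-attained
    ... | inj₂ eq = subst Attained (≡-sym eq) valB-attained
    witness : Attained (valA p n r ⊔ valB p n r) →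
              Σ (Graph p) λ G → ¬ ContainsT2 n G × edgeCount G ≡ valA p n r ⊔ valB p n r
    witness (G , free , e≤) = G , free , ≤-antisym (upper G free) e≤

  -- Doubling both values, A ≥ B amounts to r(r − 1) + 2(n − 1) ≤ (n − 4) r.
  valB≤valA : r * (r ∸ 1) + 2 * (4 + c) ≤ (1 + c) * r → valB p n r ≤ valA p n r
  valB≤valA h = ≤valA (valB p n r) (begin
    2 * valB p n r + 2 * (4 + c)         ≤⟨ +-monoˡ-≤ (2 * (4 + c)) double ⟩
    (K + r * (r ∸ 1)) + 2 * (4 + c)      ≡⟨ +-assoc K _ _ ⟩
    K + (r * (r ∸ 1) + 2 * (4 + c))      ≤⟨ +-monoʳ-≤ K h ⟩
    K + (1 + c) * r                      ∎)
    where
    open ≤-Reasoning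
    double : 2 * valB p n r ≤ K + r * (r ∸ 1)
    double = ≤-trans (≤-reflexive (*-comm 2 (valB p n r))) (≤-trans (m/n*n≤m _ 2) (≤-reflexive valB-numerator))

  valA≤valB : (1 + c) * r ≤ r * (r ∸ 1) + 2 * (4 + c) → valA p n r ≤ valB p n r
  valA≤valB h = valA≤ (valB p n r) (begin
    K + (1 + c) * r                          ≤⟨ +-monoʳ-≤ K h ⟩
    K + (r * (r ∸ 1) + 2 * (4 + c))          ≡⟨ +-assoc K _ _ ⟨
    (K + r * (r ∸ 1)) + 2 * (4 + c)          ≤⟨ +-monoˡ-≤ (2 * (4 + c)) double ⟩
    suc (2 * valB p n r + 2 * (4 + c))       ∎)
    where
    open ≤-Reasoning
    -- Halving loses a remainder of at most 1, which the `suc` in `valA≤` absorbs.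
    double : K + r * (r ∸ 1) ≤ suc (2 * valB p n r)
    double = ≤-trans (≤-reflexive (≡-sym valB-numerator))
      (≤-trans (≤-reflexive (m≡m%n+[m/n]*n numerator 2))
        (+-mono-≤ (≤-pred (m%n<n numerator 2)) (≤-reflexive (*-comm (valB p n r) 2))))
      where
      numerator : ℕ
      numerator = (n ∸ 2) * p ∸ r * (n ∸ 1 ∸ r)

-- Which of the two values is larger

-- With s = n − 3 − r, the comparison of the two values is that of r s with
-- 2(n − 1) = 2 (2 + r + s).
product-expand : ∀ c r s → r + s ≡ 2 + c → (1 + c) * r ≡ r * (r ∸ 1) + r * s
product-expand c zero    s _  = *-zeroʳ (1 + c)
product-expand c (suc r) s eq = begin
  (1 + c) * suc r          ≡⟨ cong (_* suc r) (suc-injective eq) ⟨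
  (r + s) * suc r          ≡⟨ *-comm (r + s) (suc r) ⟩
  suc r * (r + s)          ≡⟨ *-distribˡ-+ (suc r) r s ⟩
  suc r * r + suc r * s    ∎
  where open ≡-Reasoning

-- r s - 2(2 + r + s) = (r - 2)(s - 2) - 8. If one factor is 3, the other must reach 10, so r + s =
-- 13 and n = 16; if both are at least 4, r + s = 10 suffices, so n = 13. These are the thresholds
-- of `CaseA`.
large-sum : ∀ {r s} → 3 ≤ r → 3 ≤ s → 13 ≤ r + s → 2 * (2 + (r + s)) ≤ r * s
large-sum {suc (suc (suc a))} {suc (suc (suc b))} (s≤s (s≤s (s≤s _))) (s≤s (s≤s (s≤s _))) h = begin
  2 * (2 + ((3 + a) + (3 + b)))      ≡⟨ left a b ⟩
  7 + (9 + 2 * (a + b))              ≤⟨ +-monoˡ-≤ (9 + 2 * (a + b)) 7≤a+b ⟩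
  (a + b) + (9 + 2 * (a + b))        ≤⟨ m≤m+n _ (a * b) ⟩
  (a + b) + (9 + 2 * (a + b)) + a * b  ≡⟨ right a b ⟨
  (3 + a) * (3 + b)                  ∎
  where
  open ≤-Reasoning
  left : ∀ a b → 2 * (2 + ((3 + a) + (3 + b))) ≡ 7 + (9 + 2 * (a + b))
  left = solve-∀
  right : ∀ a b → (3 + a) * (3 + b) ≡ (a + b) + (9 + 2 * (a + b)) + a * b
  right = solve-∀
  shift : ∀ a b → (3 + a) + (3 + b) ≡ 6 + (a + b)
  shift = solve-∀
  7≤a+b : 7 ≤ a + b
  7≤a+b = +-cancelˡ-≤ 6 _ _ (≤-trans h (≤-reflexive (shift a b)))

medium-sum : ∀ {r s} → 4 ≤ r → 4 ≤ s → 10 ≤ r + s → 2 * (2 + (r + s)) ≤ r * s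
medium-sum {suc (suc (suc (suc a)))} {suc (suc (suc (suc b)))} (s≤s (s≤s (s≤s (s≤s _)))) (s≤s (s≤s (s≤s (s≤s _)))) h = begin
  2 * (2 + ((4 + a) + (4 + b)))      ≡⟨ left a b ⟩
  2 * 2 + (16 + 2 * (a + b))         ≤⟨ +-monoˡ-≤ (16 + 2 * (a + b)) (*-monoʳ-≤ 2 2≤a+b) ⟩
  2 * (a + b) + (16 + 2 * (a + b))   ≤⟨ m≤m+n _ (a * b) ⟩
  2 * (a + b) + (16 + 2 * (a + b)) + a * b  ≡⟨ right a b ⟨
  (4 + a) * (4 + b)                  ∎
  where
  open ≤-Reasoning
  left : ∀ a b → 2 * (2 + ((4 + a) + (4 + b))) ≡ 2 * 2 + (16 + 2 * (a + b))
  left = solve-∀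
  right : ∀ a b → (4 + a) * (4 + b) ≡ 2 * (a + b) + (16 + 2 * (a + b)) + a * b
  right = solve-∀
  shift : ∀ a b → (4 + a) + (4 + b) ≡ 8 + (a + b)
  shift = solve-∀
  2≤a+b : 2 ≤ a + b
  2≤a+b = +-cancelˡ-≤ 8 _ _ (≤-trans h (≤-reflexive (shift a b)))

small-factor : ∀ {r} s → r ≤ 2 → r * s ≤ 2 * (2 + (r + s))
small-factor {r} s r≤2 = ≤-trans (*-monoˡ-≤ s r≤2) (*-monoʳ-≤ 2 (m≤n+m s (2 + r)))

factor-3 : ∀ s → s ≤ 10 → 3 * s ≤ 2 * (2 + (3 + s))
factor-3 s s≤10 = ≤-trans (+-monoˡ-≤ (2 * s) s≤10) (≤-reflexive (lem s))
  where
  lem : ∀ s → 10 + 2 * s ≡ 2 * (2 + (3 + s))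
  lem = solve-∀

small-sum : ∀ {r s} → 4 ≤ r → 4 ≤ s → r + s ≤ 9 → r * s ≤ 2 * (2 + (r + s))
small-sum {r} {s} 4≤r 4≤s h = cases r s 4≤r 4≤s
  (+-cancelʳ-≤ 4 r 5 (≤-trans (+-monoʳ-≤ r 4≤s) h)) (+-cancelˡ-≤ 4 s 5 (≤-trans (+-monoˡ-≤ s 4≤r) h)) h
  where
  cases : ∀ r s → 4 ≤ r → 4 ≤ s → r ≤ 5 → s ≤ 5 → r + s ≤ 9 → r * s ≤ 2 * (2 + (r + s))
  cases r s 4≤r 4≤s r≤5 s≤5 h with m≤n⇒m<n∨m≡n r≤5 | m≤n⇒m<n∨m≡n s≤5
  ... | inj₂ refl | inj₂ refl = contradiction h (<⇒≱ ≤-refl)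
  ... | inj₁ r<5  | inj₁ s<5  rewrite ≤-antisym (≤-pred r<5) 4≤r | ≤-antisym (≤-pred s<5) 4≤s = m≤m+n 16 4
  ... | inj₁ r<5  | inj₂ refl rewrite ≤-antisym (≤-pred r<5) 4≤r = m≤m+n 20 2
  ... | inj₂ refl | inj₁ s<5  rewrite ≤-antisym (≤-pred s<5) 4≤s = m≤m+n 20 2

module _ (c r s : ℕ) (r+s≡ : r + s ≡ 2 + c) where

  private
    -- `1 ≤ r` guards against truncation: for `t` above `2 + c` the upper bound on `r` would be 0.
    slack : ∀ t → 1 ≤ r → r ≤ 2 + c ∸ t → t ≤ s
    slack t 1≤r r≤ = +-cancelˡ-≤ r t s (≤-trans (≤-reflexive (+-comm r t)) (≤-trans (+-monoʳ-≤ t r≤)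
      (≤-reflexive (trans (m+[n∸m]≡n t≤2+c) (≡-sym r+s≡)))))
      where
      t≤2+c : t ≤ 2 + c
      t≤2+c = ≮⇒≥ λ 2+c<t → contradiction (≤-trans 1≤r (≤-trans r≤ (≤-reflexive (m≤n⇒m∸n≡0 (<⇒≤ 2+c<t))))) λ ()

  CaseA⇒ : CaseA (5 + c) r → 2 * (2 + (r + s)) ≤ r * s
  CaseA⇒ (inj₁ (16≤n , 3≤r , r≤))     = large-sum 3≤r (slack 3 (≤-trans (s≤s z≤n) 3≤r) r≤)
    (≤-trans (+-cancelˡ-≤ 3 _ _ 16≤n) (≤-reflexive (≡-sym r+s≡)))
  CaseA⇒ (inj₂ (13≤n , _ , 4≤r , r≤)) = medium-sum 4≤r (slack 4 (≤-trans (s≤s z≤n) 4≤r) r≤)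
    (≤-trans (+-cancelˡ-≤ 3 _ _ 13≤n) (≤-reflexive (≡-sym r+s≡)))

  -- When both factors are at least 3, failure of the first branch gives r + s ≤ 12, so next to a
  -- factor 3 the other is at most 9. When both are at least 4, failure of the second branch also
  -- gives r + s ≤ 9.
  ¬CaseA⇒ : ¬ CaseA (5 + c) r → r * s ≤ 2 * (2 + (r + s))
  ¬CaseA⇒ ¬A with 3 ≤? r | 3 ≤? s
  ... | no r<3  | _      = small-factor s (≤-pred (≰⇒> r<3))
  ... | yes _   | no s<3 = ≤-trans (≤-reflexive (*-comm r s))
    (≤-trans (small-factor r (≤-pred (≰⇒> s<3))) (≤-reflexive (cong (λ t → 2 * (2 + t)) (+-comm s r))))
  ... | yes 3≤r | yes 3≤s = both
    where
    r≤ : ∀ t → t ≤ s → r ≤ 2 + c ∸ t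
    r≤ t t≤s = m+n≤o⇒m≤o∸n r (≤-trans (+-monoʳ-≤ r t≤s) (≤-reflexive r+s≡))
    c≤10 : c ≤ 10
    c≤10 = ≤-pred (≰⇒> λ 11≤c → ¬A (inj₁ (+-monoʳ-≤ 5 11≤c , 3≤r , r≤ 3 3≤s)))
    r+s≤12 : r + s ≤ 12
    r+s≤12 = ≤-trans (≤-reflexive r+s≡) (+-monoʳ-≤ 2 c≤10)
    both : r * s ≤ 2 * (2 + (r + s))
    both with m≤n⇒m<n∨m≡n 3≤r | m≤n⇒m<n∨m≡n 3≤s
    ... | inj₂ refl | _ = factor-3 s (≤-trans (+-cancelˡ-≤ 3 s 9 r+s≤12) (n≤1+n 9))
    ... | inj₁ _    | inj₂ refl = ≤-trans (≤-reflexive (*-comm r 3))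
      (≤-trans (factor-3 r (≤-trans (+-cancelʳ-≤ 3 r 9 r+s≤12) (n≤1+n 9))) (≤-reflexive (cong (λ t → 2 * (2 + t)) (+-comm 3 r))))
    ... | inj₁ 4≤r | inj₁ 4≤s = small-sum 4≤r 4≤s (≤-trans (≤-reflexive r+s≡) (+-monoʳ-≤ 2
      (≤-pred (≰⇒> λ 8≤c → ¬A (inj₂ (+-monoʳ-≤ 5 8≤c , +-monoʳ-≤ 5 c≤10 , 4≤r , r≤ 4 4≤s))))))

module _ (c r : ℕ) (r≤ : r ≤ 3 + c) where

  CaseA⇒A≥B : CaseA (5 + c) r → r * (r ∸ 1) + 2 * (4 + c) ≤ (1 + c) * r
  CaseA⇒A≥B A = compare (m≤n⇒∃[o]m+o≡n (r≤2+c A))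
    where
    r≤2+c : CaseA (5 + c) r → r ≤ 2 + c
    r≤2+c (inj₁ (_ , _ , r≤c∸1))     = ≤-trans r≤c∸1 (m∸n≤m (2 + c) 3)
    r≤2+c (inj₂ (_ , _ , _ , r≤c∸2)) = ≤-trans r≤c∸2 (m∸n≤m (2 + c) 4)
    compare : ∃[ s ] r + s ≡ 2 + c → r * (r ∸ 1) + 2 * (4 + c) ≤ (1 + c) * r
    compare (s , eq) = ≤-trans
      (+-monoʳ-≤ (r * (r ∸ 1)) (subst (λ t → 2 * (2 + t) ≤ r * s) eq (CaseA⇒ c r s eq A)))
      (≤-reflexive (≡-sym (product-expand c r s eq)))

  ¬CaseA⇒A≤B : ¬ CaseA (5 + c) r → (1 + c) * r ≤ r * (r ∸ 1) + 2 * (4 + c)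
  ¬CaseA⇒A≤B ¬A with m≤n⇒m<n∨m≡n r≤
  -- For r = n - 2 there is no natural number `s`; here r(r - 1) alone exceeds (n - 4) r.
  ... | inj₂ refl = ≤-trans (≤-reflexive (*-comm (1 + c) (3 + c)))
    (≤-trans (*-monoʳ-≤ (3 + c) (n≤1+n (1 + c))) (m≤m+n _ (2 * (4 + c))))
  ... | inj₁ r<3+c = compare (m≤n⇒∃[o]m+o≡n (≤-pred r<3+c))
    where
    compare : ∃[ s ] r + s ≡ 2 + c → (1 + c) * r ≤ r * (r ∸ 1) + 2 * (4 + c)
    compare (s , eq) = ≤-trans (≤-reflexive (product-expand c r s eq))
      (+-monoʳ-≤ (r * (r ∸ 1)) (subst (λ t → r * s ≤ 2 * (2 + t)) eq (¬CaseA⇒ c r s eq ¬A)))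

theorem3p1 : ∀ (p n k r : ℕ) → 4 ≤ n ∸ 1 → n ∸ 1 ≤ p → 1 ≤ k → r ≤ n ∸ 2 →
    p ≡ k * (n ∸ 1) + r →
    IsExT2 p n (valA p n r ⊔ valB p n r) ×
    (CaseA n r → IsExT2 p n (valA p n r)) ×
    (¬ CaseA n r → IsExT2 p n (valB p n r))
theorem3p1 _ (suc (suc (suc (suc (suc c))))) (suc k) r (s≤s (s≤s (s≤s (s≤s _)))) _ _ r≤ refl =
  ext ,
  (λ A → subst (IsExT2 p n) (m≥n⇒m⊔n≡m (valB≤valA c k r r≤ (CaseA⇒A≥B c r r≤ A))) ext) ,
  (λ ¬A → subst (IsExT2 p n) (m≤n⇒m⊔n≡n (valA≤valB c k r r≤ (¬CaseA⇒A≤B c r r≤ ¬A))) ext)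
  where
  p n : ℕ
  p = suc k * (4 + c) + r
  n = 5 + c
  ext : IsExT2 p n (valA p n r ⊔ valB p n r)
  ext = extremal c k r r≤
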